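{- Let $n\ge 1$ and let $I_{2,n}\subset\mathbb{C}[P_J]$ be the ideal of Plücker relations of the Grassmannian $\mathbb{G}_{2,n}$ of $2$-dimensional subspaces of $\mathbb{C}^{2+n}$. Non-Crossing Monomials are exactly the non-initial monomials of $I_{2,n}$ with respect to $\prec$.
   Context: The variables $P_J$ are indexed by pairs $J=(j_1,j_2)$ with $1\le j_1<j_2\le n+2$. $I_{2,n}$ is the ideal of all polynomial relations among the $2\times2$ minors $P_J$ (on columns $J$) of a generic $2\times(n+2)$ matrix; it is generated by the Plücker relations $P_{(a,b)}P_{(c,d)}-P_{(a,c)}P_{(b,d)}+P_{(a,d)}P_{(b,c)}$, $a<b<c<d$. A monomial $P_{J^1}\cdots P_{J^h}$ is non-crossing (a Non-Crossing Monomial) if there are no $p,q$ with $j_1^p<j_1^q<j_2^p<j_2^q$. The weight of $J=(j_1,j_2)$ is $w(J)=j_2-j_1$, and $w(P_{J^1}\cdots P_{J^h})=w(J^1)\cdots w(J^h)$. The order $\prec$ is the order on monomials that is reverse to weight: $M\prec M'$ whenever $w(M)>w(M')$, monomials of equal weight being ordered arbitrarily (so as to give a total order). The initial monomial $in_\prec(f)$ of a nonzero polynomial $f$ is the minimal monomial, with respect to $\prec$, occurring with nonzero coefficient in $f$. The initial ideal $in_\prec(I_{2,n})$ is the ideal generated by the initial monomials of all nonzero elements of $I_{2,n}$. A monomial is non-initial if it does not belong to $in_\prec(I_{2,n})$. -}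

module Defs where

open import Algebra.Bundles using (CommutativeRing)
open import Algebra.Definitions using (Commutative; Congruent₂)
import Algebra.Solver.Ring.NaturalCoefficients.Default
open import Data.Fin as Fin using (Fin; toℕ)
import Data.Fin.Properties as Fin
open import Data.List using (List; []; _∷_; [_]; _++_; map; foldr; cartesianProductWith)
open import Data.List.Membership.Propositional using (_∈_)
open import Data.List.Membership.Propositional.Properties using (∈-∃++)
open import Data.List.Relation.Binary.Permutation.Propositional
  using (_↭_; ↭-refl; ↭-sym; ↭-trans; prep)
open import Data.List.Relation.Binary.Permutation.Propositional.Properties
  using (shift; drop-∷; ∈-resp-↭; ¬x∷xs↭[])
open import Data.List.Relation.Unary.Any using (here)
open import Data.Nat as ℕ using (ℕ)
import Data.Nat.ListAction as ℕ
import Data.Nat.Properties as ℕ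
open import Data.Product using (∃; ∃₂; _×_; _,_)
open import Data.Product.Properties using (≡-dec)
open import Data.Rational as ℚ using (ℚ; 0ℚ; 1ℚ; ½; ∣_∣)
import Data.Rational.Properties as ℚ
open import Data.Sum using (_⊎_)
open import Level using (Level; 0ℓ; _⊔_)
open import Relation.Binary.Bundles using (Setoid)
open import Relation.Binary.Core using (Rel)
open import Relation.Binary.Definitions using (Decidable; DecidableEquality)
open import Relation.Binary.PropositionalEquality
  using (_≡_; refl; sym; trans; cong; subst)
import Relation.Binary.Reasoning.Setoid
open import Relation.Binary.Structures using (IsEquivalence; IsStrictTotalOrder)
open import Relation.Nullary using (yes; no; ¬_; does)
open import Data.Bool using (if_then_else_)
open import Relation.Unary using (Pred)

-- Reals are Cauchy sequences of rationals, equal when they differ by a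
-- null sequence.
IsCauchy : (ℕ → ℚ) → Set
IsCauchy x = ∀ ε → 0ℚ ℚ.< ε →
  ∃ λ N → ∀ m n → N ℕ.≤ m → N ℕ.≤ n → ∣ x m ℚ.- x n ∣ ℚ.< ε

record ℝ : Set where
  constructor mkℝ
  field
    seq    : ℕ → ℚ
    cauchy : IsCauchy seq
open ℝ public

infix 4 _≈ᴿ_

record _≈ᴿ_ (x y : ℝ) : Set where
  constructor null
  field
    difference : ∀ ε → 0ℚ ℚ.< ε →
      ∃ λ N → ∀ n → N ℕ.≤ n → ∣ seq x n ℚ.- seq y n ∣ ℚ.< ε

module RingIdentities {a ℓ : Level} (R : CommutativeRing a ℓ) where
  open CommutativeRing R hiding (refl; sym; trans; zero)
  open import Algebra.Properties.Ring ring
    using (-1*x≈-x; x[y-z]≈xy-xz; -0#≈0#)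
  open import Algebra.Properties.AbelianGroup +-abelianGroup
    using (⁻¹-anti-homo‿-; ⁻¹-∙-comm; ⁻¹-involutive)
  open import Algebra.Properties.CommutativeSemigroup +-commutativeSemigroup
    using (interchange)
  private
    module R = CommutativeRing R
    module Solver = Algebra.Solver.Ring.NaturalCoefficients.Default commutativeSemiring
    module ≈-Reasoning = Relation.Binary.Reasoning.Setoid setoid

    -- The solver knows no negation, so - z is passed to it as - 1# * z.
    neg : ∀ z → - z ≈ - 1# * z
    neg z = R.sym (-1*x≈-x z)

  +-diff : ∀ p q r s → (p - r) + (q - s) ≈ (p + q) - (r + s)
  +-diff p q r s = R.trans (interchange p (- r) q (- s)) (+-congˡ (⁻¹-∙-comm r s))

  *-expand : ∀ p q r s →
    p * (q - s) + s * (p - r) ≈ (p * q - p * s) + (p * s - r * s)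
  *-expand p q r s = +-cong (x[y-z]≈xy-xz p q s)
    (R.trans (x[y-z]≈xy-xz s p r) (+-cong (*-comm s p) (-‿cong (*-comm s r))))

  swap-diff : ∀ p q → - (p - q) ≈ q - p
  swap-diff = ⁻¹-anti-homo‿-

  neg-diff : ∀ p q → q - p ≈ - p - - q
  neg-diff p q = R.trans (+-comm q (- p)) (+-congˡ (R.sym (⁻¹-involutive q)))

  assoc-re : ∀ x y u v s t →
    (x * u - y * v) * s - (x * v + y * u) * t
      ≈ x * (u * s - v * t) - y * (u * t + v * s)
  assoc-re x y u v s t = begin
    (x * u - y * v) * s - (x * v + y * u) * t
      ≈⟨ +-cong (*-congʳ (+-congˡ (neg _))) (neg _) ⟩
    (x * u + - 1# * (y * v)) * s + - 1# * ((x * v + y * u) * t)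
      ≈⟨ identity (- 1#) x y u v s t ⟩
    x * (u * s + - 1# * (v * t)) + - 1# * (y * (u * t + v * s))
      ≈⟨ +-cong (*-congˡ (+-congˡ (neg _))) (neg _) ⟨
    x * (u * s - v * t) - y * (u * t + v * s) ∎
    where
    open ≈-Reasoning
    identity : ∀ m x y u v s t →
      (x * u + m * (y * v)) * s + m * ((x * v + y * u) * t)
        ≈ x * (u * s + m * (v * t)) + m * (y * (u * t + v * s))
    identity = solve 7 (λ m x y u v s t →
      (x :* u :+ m :* (y :* v)) :* s :+ m :* ((x :* v :+ y :* u) :* t)
        := x :* (u :* s :+ m :* (v :* t)) :+ m :* (y :* (u :* t :+ v :* s))) R.refl
      where open Solver

  assoc-im : ∀ x y u v s t →
    (x * u - y * v) * t + (x * v + y * u) * s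
      ≈ x * (u * t + v * s) + y * (u * s - v * t)
  assoc-im x y u v s t = begin
    (x * u - y * v) * t + (x * v + y * u) * s
      ≈⟨ +-congʳ (*-congʳ (+-congˡ (neg _))) ⟩
    (x * u + - 1# * (y * v)) * t + (x * v + y * u) * s
      ≈⟨ identity (- 1#) x y u v s t ⟩
    x * (u * t + v * s) + y * (u * s + - 1# * (v * t))
      ≈⟨ +-congˡ (*-congˡ (+-congˡ (neg _))) ⟨
    x * (u * t + v * s) + y * (u * s - v * t) ∎
    where
    open ≈-Reasoning
    identity : ∀ m x y u v s t →
      (x * u + m * (y * v)) * t + (x * v + y * u) * s
        ≈ x * (u * t + v * s) + y * (u * s + m * (v * t))
    identity = solve 7 (λ m x y u v s t →
      (x :* u :+ m :* (y :* v)) :* t :+ (x :* v :+ y :* u) :* s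
        := x :* (u :* t :+ v :* s) :+ y :* (u :* s :+ m :* (v :* t))) R.refl
      where open Solver

  distˡ-re : ∀ x y u v s t →
    x * (u + s) - y * (v + t) ≈ (x * u - y * v) + (x * s - y * t)
  distˡ-re x y u v s t =
    R.trans (+-cong (distribˡ x u s) (-‿cong (distribˡ y v t)))
          (R.sym (+-diff (x * u) (x * s) (y * v) (y * t)))

  distˡ-im : ∀ x y u v s t →
    x * (v + t) + y * (u + s) ≈ (x * v + y * u) + (x * t + y * s)
  distˡ-im x y u v s t =
    R.trans (+-cong (distribˡ x v t) (distribˡ y u s))
          (interchange (x * v) (x * t) (y * u) (y * s))

  comm-re : ∀ x y u v → x * u - y * v ≈ u * x - v * y
  comm-re x y u v = +-cong (*-comm x u) (-‿cong (*-comm y v))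

  comm-im : ∀ x y u v → x * v + y * u ≈ u * y + v * x
  comm-im x y u v = R.trans (+-comm (x * v) (y * u)) (+-cong (*-comm y u) (*-comm x v))

  minus-zero : ∀ {u v w} → u ≈ w → v ≈ 0# → u - v ≈ w
  minus-zero p q = R.trans (+-cong p (R.trans (-‿cong q) -0#≈0#)) (+-identityʳ _)

  plus-zero : ∀ {u v w} → u ≈ w → v ≈ 0# → u + v ≈ w
  plus-zero p q = R.trans (+-cong p q) (+-identityʳ _)

module ℝ-Lemmas where
  open RingIdentities ℚ.+-*-commutativeRing
    using (*-expand; swap-diff; neg-diff)
  open RingIdentities ℚ.+-*-commutativeRing public using (+-diff)

  half>0 : ∀ {ε} → 0ℚ ℚ.< ε → 0ℚ ℚ.< ½ ℚ.* ε
  half>0 {ε} 0<ε = subst (ℚ._< ½ ℚ.* ε) (ℚ.*-zeroʳ ½) (ℚ.*-monoʳ-<-pos ½ 0<ε)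

  half+half : ∀ ε → ½ ℚ.* ε ℚ.+ ½ ℚ.* ε ≡ ε
  half+half ε = trans (sym (ℚ.*-distribʳ-+ ε ½ ½)) (ℚ.*-identityˡ ε)

  +-small : ∀ {ε} u v → ∣ u ∣ ℚ.< ½ ℚ.* ε → ∣ v ∣ ℚ.< ½ ℚ.* ε → ∣ u ℚ.+ v ∣ ℚ.< ε
  +-small {ε} u v p q = ℚ.≤-<-trans (ℚ.∣p+q∣≤∣p∣+∣q∣ u v)
    (subst (∣ u ∣ ℚ.+ ∣ v ∣ ℚ.<_) (half+half ε) (ℚ.+-mono-< p q))

  quot : ∀ ε B → 0ℚ ℚ.< ε → 0ℚ ℚ.< B → ∃ λ δ → 0ℚ ℚ.< δ × B ℚ.* δ ≡ ε
  quot ε B 0<ε 0<B = inv ℚ.* ε , 0<δ , B*δ≡ε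
    where
    instance
      B-pos : ℚ.Positive B
      B-pos = ℚ.positive 0<B
      B-nz : ℚ.NonZero B
      B-nz = ℚ.pos⇒nonZero B
    inv : ℚ
    inv = ℚ.1/ B
    instance
      inv-pos : ℚ.Positive inv
      inv-pos = ℚ.1/pos⇒pos B
    0<δ : 0ℚ ℚ.< inv ℚ.* ε
    0<δ = subst (ℚ._< inv ℚ.* ε) (ℚ.*-zeroʳ inv) (ℚ.*-monoʳ-<-pos inv 0<ε)
    B*δ≡ε : B ℚ.* (inv ℚ.* ε) ≡ ε
    B*δ≡ε = trans (sym (ℚ.*-assoc B inv ε))
              (trans (cong (ℚ._* ε) (ℚ.*-inverseʳ B)) (ℚ.*-identityˡ ε))

  *-small : ∀ {B δ} u v → 0ℚ ℚ.< B → ∣ u ∣ ℚ.< B → ∣ v ∣ ℚ.< δ → ∣ u ℚ.* v ∣ ℚ.< B ℚ.* δ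
  *-small {B} {δ} u v 0<B u<B v<δ = subst (ℚ._< B ℚ.* δ) (sym (ℚ.∣p*q∣≡∣p∣*∣q∣ u v))
    (ℚ.≤-<-trans
      (ℚ.*-monoʳ-≤-nonNeg ∣ v ∣ {{ℚ.∣-∣-nonNeg v}} (ℚ.<⇒≤ u<B))
      (ℚ.*-monoʳ-<-pos B {{ℚ.positive 0<B}} v<δ))

  ∣-∣-sym : ∀ p q → ∣ p ℚ.- q ∣ ≡ ∣ q ℚ.- p ∣
  ∣-∣-sym p q = trans (sym (ℚ.∣-p∣≡∣p∣ (p ℚ.- q))) (cong ∣_∣ (swap-diff p q))

  ∣-∣-neg : ∀ p q → ∣ p ℚ.- q ∣ ≡ ∣ (ℚ.- p) ℚ.- (ℚ.- q) ∣
  ∣-∣-neg p q = trans (∣-∣-sym p q) (cong ∣_∣ (neg-diff p q))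

  cancel : ∀ p q → p ℚ.- q ℚ.+ q ≡ p
  cancel p q = trans (ℚ.+-assoc p (ℚ.- q) q)
    (trans (cong (p ℚ.+_) (ℚ.+-inverseˡ q)) (ℚ.+-identityʳ p))

  telescope : ∀ p q r → (p ℚ.- q) ℚ.+ (q ℚ.- r) ≡ p ℚ.- r
  telescope p q r = trans (sym (ℚ.+-assoc (p ℚ.- q) q (ℚ.- r)))
    (cong (ℚ._- r) (cancel p q))

  bound : ∀ {x} → IsCauchy x → ∃₂ λ B N → 0ℚ ℚ.< B × (∀ n → N ℕ.≤ n → ∣ x n ∣ ℚ.< B)
  bound {x} c with c 1ℚ (ℚ.positive⁻¹ 1ℚ)
  ... | N , close = 1ℚ ℚ.+ ∣ x N ∣ , N
      , ℚ.+-mono-<-≤ (ℚ.positive⁻¹ 1ℚ) (ℚ.0≤∣p∣ (x N))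
      , λ n N≤n → ℚ.≤-<-trans
          (subst (λ t → ∣ t ∣ ℚ.≤ ∣ x n ℚ.- x N ∣ ℚ.+ ∣ x N ∣) (cancel (x n) (x N))
            (ℚ.∣p+q∣≤∣p∣+∣q∣ (x n ℚ.- x N) (x N)))
          (ℚ.+-monoˡ-< ∣ x N ∣ (close n N N≤n ℕ.≤-refl))

  *-diff : ∀ p q r s → p ℚ.* (q ℚ.- s) ℚ.+ s ℚ.* (p ℚ.- r) ≡ p ℚ.* q ℚ.- r ℚ.* s
  *-diff p q r s = trans (*-expand p q r s) (telescope (p ℚ.* q) (p ℚ.* s) (r ℚ.* s))

  ⊔ˡ : ∀ {M N n} → M ℕ.⊔ N ℕ.≤ n → M ℕ.≤ n
  ⊔ˡ {M} {N} = ℕ.≤-trans (ℕ.m≤m⊔n M N)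

  ⊔ʳ : ∀ {M N n} → M ℕ.⊔ N ℕ.≤ n → N ℕ.≤ n
  ⊔ʳ {M} {N} = ℕ.≤-trans (ℕ.m≤n⊔m M N)

  const-cauchy : ∀ q → IsCauchy (λ _ → q)
  const-cauchy q ε 0<ε = 0 , λ _ _ _ _ →
    subst (λ t → ∣ t ∣ ℚ.< ε) (sym (ℚ.+-inverseʳ q)) 0<ε

  +-cauchy : ∀ {x y} → IsCauchy x → IsCauchy y → IsCauchy (λ n → x n ℚ.+ y n)
  +-cauchy {x} {y} cx cy ε 0<ε with cx _ (half>0 0<ε) | cy _ (half>0 0<ε)
  ... | M , p | N , q = M ℕ.⊔ N , λ m n m≥ n≥ →
    subst (λ t → ∣ t ∣ ℚ.< ε) (+-diff (x m) (y m) (x n) (y n))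
      (+-small (x m ℚ.- x n) (y m ℚ.- y n)
        (p m n (⊔ˡ {M} m≥) (⊔ˡ {M} n≥)) (q m n (⊔ʳ {M} m≥) (⊔ʳ {M} n≥)))

  neg-cauchy : ∀ {x} → IsCauchy x → IsCauchy (λ n → ℚ.- x n)
  neg-cauchy {x} cx ε 0<ε with cx ε 0<ε
  ... | N , p = N , λ m n m≥ n≥ → subst (ℚ._< ε) (∣-∣-neg (x m) (x n)) (p m n m≥ n≥)

  *-cauchy : ∀ {x y} → IsCauchy x → IsCauchy y → IsCauchy (λ n → x n ℚ.* y n)
  *-cauchy {x} {y} cx cy ε 0<ε =
    let B , K , 0<B , bx = bound {x} cx
        C , L , 0<C , by = bound {y} cy
        δ , 0<δ , Bδ = quot _ B (half>0 0<ε) 0<B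
        η , 0<η , Cη = quot _ C (half>0 0<ε) 0<C
        M , p = cx η 0<η
        N , q = cy δ 0<δ
    in (K ℕ.⊔ L) ℕ.⊔ (M ℕ.⊔ N) , λ m n m≥ n≥ →
    let m≥KL = ⊔ˡ {K ℕ.⊔ L} m≥ ; n≥KL = ⊔ˡ {K ℕ.⊔ L} n≥
        m≥MN = ⊔ʳ {K ℕ.⊔ L} m≥ ; n≥MN = ⊔ʳ {K ℕ.⊔ L} n≥
    in subst (λ t → ∣ t ∣ ℚ.< ε) (*-diff (x m) (y m) (x n) (y n))
      (+-small (x m ℚ.* (y m ℚ.- y n)) (y n ℚ.* (x m ℚ.- x n))
        (subst (∣ x m ℚ.* (y m ℚ.- y n) ∣ ℚ.<_) Bδ
          (*-small (x m) (y m ℚ.- y n) 0<B (bx m (⊔ˡ {K} m≥KL))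
            (q m n (⊔ʳ {M} m≥MN) (⊔ʳ {M} n≥MN))))
        (subst (∣ y n ℚ.* (x m ℚ.- x n) ∣ ℚ.<_) Cη
          (*-small (y n) (x m ℚ.- x n) 0<C (by n (⊔ʳ {K} n≥KL))
            (p m n (⊔ˡ {M} m≥MN) (⊔ˡ {M} n≥MN)))))

open ℝ-Lemmas

0ᴿ 1ᴿ : ℝ
0ᴿ = mkℝ (λ _ → 0ℚ) (const-cauchy 0ℚ)
1ᴿ = mkℝ (λ _ → 1ℚ) (const-cauchy 1ℚ)

infixl 6 _+ᴿ_
infixl 7 _*ᴿ_
infix  8 -ᴿ_

_+ᴿ_ _*ᴿ_ : ℝ → ℝ → ℝ
x +ᴿ y = mkℝ (λ n → seq x n ℚ.+ seq y n) (+-cauchy {seq x} {seq y} (cauchy x) (cauchy y))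
x *ᴿ y = mkℝ (λ n → seq x n ℚ.* seq y n) (*-cauchy {seq x} {seq y} (cauchy x) (cauchy y))

-ᴿ_ : ℝ → ℝ
-ᴿ x = mkℝ (λ n → ℚ.- seq x n) (neg-cauchy {seq x} (cauchy x))

module ℝ-Laws where

  pointwise : ∀ {x y} → (∀ n → seq x n ≡ seq y n) → x ≈ᴿ y
  pointwise {x} {y} eq = null λ ε 0<ε → 0 , λ n _ →
    subst (λ t → ∣ t ∣ ℚ.< ε)
      (sym (trans (cong (ℚ._- seq y n) (eq n)) (ℚ.+-inverseʳ (seq y n)))) 0<ε

  ≈ᴿ-refl : ∀ {x} → x ≈ᴿ x
  ≈ᴿ-refl = pointwise λ _ → refl

  ≈ᴿ-sym : ∀ {x y} → x ≈ᴿ y → y ≈ᴿ x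
  ≈ᴿ-sym {x} {y} (null x≈y) = null λ ε 0<ε →
    let N , p = x≈y ε 0<ε in N , λ n n≥ →
    subst (ℚ._< ε) (∣-∣-sym (seq x n) (seq y n)) (p n n≥)

  ≈ᴿ-trans : ∀ {x y z} → x ≈ᴿ y → y ≈ᴿ z → x ≈ᴿ z
  ≈ᴿ-trans {x} {y} {z} (null x≈y) (null y≈z) = null λ ε 0<ε →
    let M , p = x≈y _ (half>0 0<ε) ; N , q = y≈z _ (half>0 0<ε) in M ℕ.⊔ N , λ n n≥ →
    subst (λ t → ∣ t ∣ ℚ.< ε) (telescope (seq x n) (seq y n) (seq z n))
      (+-small (seq x n ℚ.- seq y n) (seq y n ℚ.- seq z n)
        (p n (⊔ˡ {M} n≥)) (q n (⊔ʳ {M} n≥)))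

  +ᴿ-cong : ∀ {x x′ y y′} → x ≈ᴿ x′ → y ≈ᴿ y′ → x +ᴿ y ≈ᴿ x′ +ᴿ y′
  +ᴿ-cong {x} {x′} {y} {y′} (null x≈) (null y≈) = null λ ε 0<ε →
    let M , p = x≈ _ (half>0 0<ε) ; N , q = y≈ _ (half>0 0<ε) in M ℕ.⊔ N , λ n n≥ →
    subst (λ t → ∣ t ∣ ℚ.< ε) (+-diff (seq x n) (seq y n) (seq x′ n) (seq y′ n))
      (+-small (seq x n ℚ.- seq x′ n) (seq y n ℚ.- seq y′ n)
        (p n (⊔ˡ {M} n≥)) (q n (⊔ʳ {M} n≥)))

  -ᴿ-cong : ∀ {x x′} → x ≈ᴿ x′ → -ᴿ x ≈ᴿ -ᴿ x′
  -ᴿ-cong {x} {x′} (null x≈) = null λ ε 0<ε →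
    let N , p = x≈ ε 0<ε in N , λ n n≥ →
    subst (ℚ._< ε) (∣-∣-neg (seq x n) (seq x′ n)) (p n n≥)

  *ᴿ-cong : ∀ {x x′ y y′} → x ≈ᴿ x′ → y ≈ᴿ y′ → x *ᴿ y ≈ᴿ x′ *ᴿ y′
  *ᴿ-cong {x} {x′} {y} {y′} (null x≈) (null y≈) = null λ ε 0<ε →
    let B , K , 0<B , bx = bound {seq x} (cauchy x)
        C , L , 0<C , by = bound {seq y′} (cauchy y′)
        δ , 0<δ , Bδ = quot _ B (half>0 0<ε) 0<B
        η , 0<η , Cη = quot _ C (half>0 0<ε) 0<C
        M , p = x≈ η 0<η
        N , q = y≈ δ 0<δ
    in (K ℕ.⊔ L) ℕ.⊔ (M ℕ.⊔ N) , λ n n≥ →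
    let n≥KL = ⊔ˡ {K ℕ.⊔ L} n≥ ; n≥MN = ⊔ʳ {K ℕ.⊔ L} n≥
    in subst (λ t → ∣ t ∣ ℚ.< ε) (*-diff (seq x n) (seq y n) (seq x′ n) (seq y′ n))
      (+-small (seq x n ℚ.* (seq y n ℚ.- seq y′ n)) (seq y′ n ℚ.* (seq x n ℚ.- seq x′ n))
        (subst (∣ seq x n ℚ.* (seq y n ℚ.- seq y′ n) ∣ ℚ.<_) Bδ
          (*-small (seq x n) (seq y n ℚ.- seq y′ n) 0<B (bx n (⊔ˡ {K} n≥KL))
            (q n (⊔ʳ {M} n≥MN))))
        (subst (∣ seq y′ n ℚ.* (seq x n ℚ.- seq x′ n) ∣ ℚ.<_) Cη
          (*-small (seq y′ n) (seq x n ℚ.- seq x′ n) 0<C (by n (⊔ʳ {K} n≥KL))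
            (p n (⊔ˡ {M} n≥MN)))))

open ℝ-Laws

ℝ-commutativeRing : CommutativeRing 0ℓ 0ℓ
ℝ-commutativeRing = record
  { Carrier = ℝ ; _≈_ = _≈ᴿ_ ; _+_ = _+ᴿ_ ; _*_ = _*ᴿ_ ; -_ = -ᴿ_ ; 0# = 0ᴿ ; 1# = 1ᴿ
  ; isCommutativeRing = record
    { isRing = record
      { +-isAbelianGroup = record
        { isGroup = record
          { isMonoid = record
            { isSemigroup = record
              { isMagma = record
                { isEquivalence = record
                  { refl  = ≈ᴿ-refl
                  ; sym   = ≈ᴿ-sym
                  ; trans = ≈ᴿ-trans }
                ; ∙-cong = +ᴿ-cong }
              ; assoc = λ x y z → pointwise
                  λ n → ℚ.+-assoc (seq x n) (seq y n) (seq z n) }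
            ; identity =
                (λ x → pointwise λ n → ℚ.+-identityˡ (seq x n))
              , (λ x → pointwise λ n → ℚ.+-identityʳ (seq x n)) }
          ; inverse =
              (λ x → pointwise λ n → ℚ.+-inverseˡ (seq x n))
            , (λ x → pointwise λ n → ℚ.+-inverseʳ (seq x n))
          ; ⁻¹-cong = -ᴿ-cong }
        ; comm = λ x y → pointwise λ n → ℚ.+-comm (seq x n) (seq y n) }
      ; *-cong = *ᴿ-cong
      ; *-assoc = λ x y z → pointwise
          λ n → ℚ.*-assoc (seq x n) (seq y n) (seq z n)
      ; *-identity =
          (λ x → pointwise λ n → ℚ.*-identityˡ (seq x n))
        , (λ x → pointwise λ n → ℚ.*-identityʳ (seq x n))
      ; distrib =
          (λ x y z → pointwise
            λ n → ℚ.*-distribˡ-+ (seq x n) (seq y n) (seq z n))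
        , (λ x y z → pointwise
            λ n → ℚ.*-distribʳ-+ (seq x n) (seq y n) (seq z n)) }
    ; *-comm = λ x y → pointwise λ n → ℚ.*-comm (seq x n) (seq y n) } }

module Complexification {a ℓ : Level} (R : CommutativeRing a ℓ) where
  open CommutativeRing R hiding (refl; sym; trans)
  open RingIdentities R
  private module R = CommutativeRing R

  record Complex : Set a where
    constructor _+i_
    field
      re im : Carrier
  open Complex public

  infix 4 _≈ᶜ_

  record _≈ᶜ_ (z w : Complex) : Set ℓ where
    constructor _,_
    field
      re-≈ : re z ≈ re w
      im-≈ : im z ≈ im w
  open _≈ᶜ_ public

  infixl 6 _+ᶜ_
  infixl 7 _*ᶜ_
  infix  8 -ᶜ_

  _+ᶜ_ _*ᶜ_ : Complex → Complex → Complex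
  (x +i y) +ᶜ (u +i v) = (x + u) +i (y + v)
  (x +i y) *ᶜ (u +i v) = (x * u - y * v) +i (x * v + y * u)

  -ᶜ_ : Complex → Complex
  -ᶜ (x +i y) = (- x) +i (- y)

  0ᶜ 1ᶜ : Complex
  0ᶜ = 0# +i 0#
  1ᶜ = 1# +i 0#

  private
    ≈ᶜ-isEquivalence : IsEquivalence _≈ᶜ_
    ≈ᶜ-isEquivalence = record
      { refl  = R.refl , R.refl
      ; sym   = λ (p , q) → R.sym p , R.sym q
      ; trans = λ (p , q) (r , s) → R.trans p r , R.trans q s }

    +ᶜ-cong : Congruent₂ _≈ᶜ_ _+ᶜ_
    +ᶜ-cong (p , q) (r , s) = +-cong p r , +-cong q s

    *ᶜ-comm : Commutative _≈ᶜ_ _*ᶜ_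
    *ᶜ-comm (x +i y) (u +i v) = comm-re x y u v , comm-im x y u v

    ≈ᶜ-setoid : Setoid a ℓ
    ≈ᶜ-setoid = record { isEquivalence = ≈ᶜ-isEquivalence }

    open import Algebra.Consequences.Setoid ≈ᶜ-setoid using (comm∧idˡ⇒id; comm∧distrˡ⇒distr)

  complexRing : CommutativeRing a ℓ
  complexRing = record
    { Carrier = Complex ; _≈_ = _≈ᶜ_ ; _+_ = _+ᶜ_ ; _*_ = _*ᶜ_ ; -_ = -ᶜ_
    ; 0# = 0ᶜ ; 1# = 1ᶜ
    ; isCommutativeRing = record
      { isRing = record
        { +-isAbelianGroup = record
          { isGroup = record
            { isMonoid = record
              { isSemigroup = record
                { isMagma = record
                  { isEquivalence = ≈ᶜ-isEquivalence
                  ; ∙-cong = +ᶜ-cong }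
                ; assoc = λ (x +i y) (u +i v) (s +i t) → +-assoc x u s , +-assoc y v t }
              ; identity = (λ (x +i y) → +-identityˡ x , +-identityˡ y)
                         , (λ (x +i y) → +-identityʳ x , +-identityʳ y) }
            ; inverse = (λ (x +i y) → -‿inverseˡ x , -‿inverseˡ y)
                      , (λ (x +i y) → -‿inverseʳ x , -‿inverseʳ y)
            ; ⁻¹-cong = λ (p , q) → -‿cong p , -‿cong q }
          ; comm = λ (x +i y) (u +i v) → +-comm x u , +-comm y v }
        ; *-cong = λ (p , q) (r , s) →
              +-cong (*-cong p r) (-‿cong (*-cong q s))
            , +-cong (*-cong p s) (*-cong q r)
        ; *-assoc = λ (x +i y) (u +i v) (s +i t) →
            assoc-re x y u v s t , assoc-im x y u v s t
        ; *-identity = comm∧idˡ⇒id *ᶜ-comm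
            (λ (x +i y) → minus-zero (*-identityˡ x) (zeroˡ y)
                        , plus-zero (*-identityˡ y) (zeroˡ x))
        ; distrib = comm∧distrˡ⇒distr +ᶜ-cong *ᶜ-comm
            (λ (x +i y) (u +i v) (s +i t) →
                distˡ-re x y u v s t , distˡ-im x y u v s t) }
      ; *-comm = *ᶜ-comm } }

ℂ-commutativeRing : CommutativeRing 0ℓ 0ℓ
ℂ-commutativeRing = Complexification.complexRing ℝ-commutativeRing

module _ {a : Level} {A : Set a} (_≟_ : DecidableEquality A) where
  open import Data.List.Membership.DecPropositional _≟_ using (_∈?_)

  permutation? : Decidable (_↭_ {A = A})
  permutation? []       []       = yes ↭-refl
  permutation? []       (y ∷ ys) = no λ p → ¬x∷xs↭[] (↭-sym p)
  permutation? (x ∷ xs) ys with x ∈? ys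
  ... | no  x∉ys = no λ p → x∉ys (∈-resp-↭ p (here refl))
  ... | yes x∈ys with ∈-∃++ x∈ys
  ...   | us , vs , refl with permutation? xs (us ++ vs)
  ...     | yes p = yes (↭-trans (prep x p) (↭-sym (shift x us vs)))
  ...     | no ¬p = no λ q → ¬p (drop-∷ (↭-trans q (shift x us vs)))

-- A monomial is the list of its factors, two lists being the same
-- monomial when they are permutations of each other.  A polynomial is a
-- formal sum of terms, considered up to equality of all coefficients.
module Polynomials {a c ℓ : Level} (R : CommutativeRing c ℓ)
                   {Var : Set a} (_≟_ : DecidableEquality Var) where
  open CommutativeRing R using (Carrier; _≈_; _+_; _*_; -_; 0#; 1#)

  Monomial : Set a
  Monomial = List Var

  Polynomial : Set (a ⊔ c)
  Polynomial = List (Carrier × Monomial)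

  coeff : Polynomial → Monomial → Carrier
  coeff []             m = 0#
  coeff ((k , m′) ∷ f) m = (if does (permutation? _≟_ m′ m) then k else 0#) + coeff f m

  infix 4 _≈ₚ_

  _≈ₚ_ : Rel Polynomial (a ⊔ ℓ)
  f ≈ₚ g = ∀ m → coeff f m ≈ coeff g m

  0ₚ : Polynomial
  0ₚ = []

  constant : Carrier → Polynomial
  constant k = [ k , [] ]

  monomial : Monomial → Polynomial
  monomial m = [ 1# , m ]

  var : Var → Polynomial
  var v = monomial [ v ]

  infixl 6 _+ₚ_ _-ₚ_
  infixl 7 _*ₚ_
  infix  8 -ₚ_

  -ₚ_ : Polynomial → Polynomial
  -ₚ f = map (λ (k , m) → (- k) , m) f

  _+ₚ_ _-ₚ_ _*ₚ_ : Polynomial → Polynomial → Polynomial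
  f +ₚ g = f ++ g
  f -ₚ g = f +ₚ (-ₚ g)
  f *ₚ g = cartesianProductWith (λ (k , m) (k′ , m′) → (k * k′) , (m ++ m′)) f g

  ∑ ∏ : List Polynomial → Polynomial
  ∑ = foldr _+ₚ_ 0ₚ
  ∏ = foldr _*ₚ_ (constant 1#)

  Occurs : Monomial → Polynomial → Set ℓ
  Occurs m f = ¬ (coeff f m ≈ 0#)

  data ⟨_⟩ {s : Level} (S : Pred Polynomial s) : Pred Polynomial (a ⊔ c ⊔ ℓ ⊔ s) where
    generator : ∀ {f} → S f → ⟨ S ⟩ f
    zero      : ⟨ S ⟩ 0ₚ
    add       : ∀ {f g} → ⟨ S ⟩ f → ⟨ S ⟩ g → ⟨ S ⟩ (f +ₚ g)
    absorb    : ∀ g {f} → ⟨ S ⟩ f → ⟨ S ⟩ (g *ₚ f)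
    respects  : ∀ {f g} → f ≈ₚ g → ⟨ S ⟩ f → ⟨ S ⟩ g

  -- The conditions force f to be nonzero.
  IsInitial : {s : Level} → Rel Monomial s → Polynomial → Monomial → Set (a ⊔ ℓ ⊔ s)
  IsInitial _≺_ f m = Occurs m f × (∀ m′ → Occurs m′ f → m ≺ m′ ⊎ m ↭ m′)

  InitialMonomialOf : {s t : Level} → Rel Monomial s → Pred Polynomial t →
                      Pred Polynomial (a ⊔ c ⊔ ℓ ⊔ s ⊔ t)
  InitialMonomialOf _≺_ I g = ∃₂ λ f m → I f × IsInitial _≺_ f m × g ≈ₚ monomial m

  in-ideal : {s t : Level} → Rel Monomial s → Pred Polynomial t →
             Pred Polynomial (a ⊔ c ⊔ ℓ ⊔ s ⊔ t)
  in-ideal _≺_ I = ⟨ InitialMonomialOf _≺_ I ⟩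

module Substitution {a b c ℓ : Level} (R : CommutativeRing c ℓ)
                    {V : Set a} (_≟ⱽ_ : DecidableEquality V)
                    {W : Set b} (_≟ᵂ_ : DecidableEquality W) where
  private
    module V = Polynomials R _≟ⱽ_
    module W = Polynomials R _≟ᵂ_

  substitute : (V → W.Polynomial) → V.Polynomial → W.Polynomial
  substitute σ f = W.∑ (map (λ (k , m) → W.constant k W.*ₚ W.∏ (map σ m)) f)

-- The columns 1, …, n+2 are numbered from 0.
record Index (n : ℕ) : Set where
  constructor index
  field
    j₁ j₂ : Fin (n ℕ.+ 2)
    j₁<j₂ : j₁ Fin.< j₂
open Index public

_≟ᴵ_ : ∀ {n} → DecidableEquality (Index n)
index i j p ≟ᴵ index i′ j′ p′ with i Fin.≟ i′ | j Fin.≟ j′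
... | no i≢i′  | _        = no λ where refl → i≢i′ refl
... | yes _    | no j≢j′  = no λ where refl → j≢j′ refl
... | yes refl | yes refl = yes (cong (index i j) (ℕ.<-irrelevant p p′))

-- Position (r , j) of a 2 × (n + 2) matrix.
Entry : ℕ → Set
Entry n = Fin 2 × Fin (n ℕ.+ 2)

_≟ᴱ_ : ∀ {n} → DecidableEquality (Entry n)
_≟ᴱ_ = ≡-dec Fin._≟_ Fin._≟_

module PlückerIdeal {c ℓ : Level} (R : CommutativeRing c ℓ) (n : ℕ) where
  module R[P] = Polynomials R (_≟ᴵ_ {n})
  module R[X] = Polynomials R (_≟ᴱ_ {n})
  open Substitution R (_≟ᴵ_ {n}) (_≟ᴱ_ {n})
  open R[X] using (var; _*ₚ_; _-ₚ_; _≈ₚ_; 0ₚ)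

  minor : Index n → R[X].Polynomial
  minor J = var (Fin.zero , j₁ J) *ₚ var (Fin.suc Fin.zero , j₂ J)
         -ₚ var (Fin.zero , j₂ J) *ₚ var (Fin.suc Fin.zero , j₁ J)

  -- All polynomial relations among the minors of the generic matrix.
  I₂ : Pred R[P].Polynomial ℓ
  I₂ f = substitute minor f ≈ₚ 0ₚ

module ℂ[P] (n : ℕ) = Polynomials ℂ-commutativeRing (_≟ᴵ_ {n})

module _ {n : ℕ} where
  open ℂ[P] n
  open PlückerIdeal ℂ-commutativeRing n using (I₂)

  Crosses : Index n → Index n → Set
  Crosses J K = j₁ J Fin.< j₁ K × j₁ K Fin.< j₂ J × j₂ J Fin.< j₂ K

  NonCrossing : Monomial → Set
  NonCrossing M = ∀ {J K} → J ∈ M → K ∈ M → ¬ Crosses J K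

  weightᴵ : Index n → ℕ
  weightᴵ J = toℕ (j₂ J) ℕ.∸ toℕ (j₁ J)

  weight : Monomial → ℕ
  weight M = ℕ.product (map weightᴵ M)

  record IsReverseWeightOrder {s : Level} (_≺_ : Rel Monomial s) : Set s where
    field
      isStrictTotalOrder : IsStrictTotalOrder _↭_ _≺_
      reverse-weight     : ∀ {M M′} → weight M′ ℕ.< weight M → M ≺ M′

  NonInitial : {s : Level} → Rel Monomial s → Monomial → Set s
  NonInitial _≺_ M = ¬ in-ideal _≺_ I₂ (monomial M)

{-# OPTIONS --safe #-}
module Submission where

-- Uncrossing a crossing pair by a Plücker relation, P_ac P_bd = P_ab P_cd + P_ad P_bc,
-- strictly lowers the weight, since (c − a)(d − b) = (b − a)(d − c) + (d − a)(c − b) with all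
-- gaps positive.  So every crossing monomial is initial, and every polynomial is congruent
-- modulo the ideal to a combination of non-crossing monomials in which a non-crossing
-- monomial of maximal weight keeps its coefficient.  That coefficient is zero for a
-- polynomial of the ideal, because non-crossing monomials are independent: their
-- expansions have distinct diagonal terms, a non-crossing matching being determined by
-- its opening and closing points.  Hence no non-crossing monomial is initial, nor a multiple
-- of an initial one, as divisors of non-crossing monomials are non-crossing.

open import Defs
open import Data.Nat using (ℕ; _≤_)
open import Function.Bundles using (_⇔_)
open import Level using (Level)
open import Relation.Binary.Core using (Rel)

open import Algebra.Bundles using (CommutativeRing)
import Algebra.Solver.Ring.NaturalCoefficients.Default
open import Data.Fin as Fin using (Fin; toℕ)
import Data.Fin.Properties as Fin
open import Data.List using (List; []; _∷_; _++_; map; filter; length)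
open import Data.List.Membership.Propositional using (_∈_; find; lose)
open import Data.List.Membership.Propositional.Properties using (∈-∃++; ∈-++⁺ʳ)
open import Data.List.Properties using (++-assoc; filter-notAll; map-++)
open import Data.List.Relation.Binary.Permutation.Propositional as Perm
  using (_↭_; ↭-refl; ↭-sym; ↭-trans; ↭-reflexive)
open import Data.List.Relation.Binary.Permutation.Propositional.Properties as Perm
  using (++⁺ˡ; ++⁺ʳ; ++-comm; shift; shifts; ∈-resp-↭; drop-∷; ↭-length; ↭-empty-inv)
open import Data.List.Relation.Unary.All as All using (All; []; _∷_)
import Data.List.Relation.Unary.All.Properties as All
open import Data.List.Relation.Unary.Any using (here; there; any?)
open import Data.Nat as ℕ using (zero; suc; s≤s⁻¹)
open import Data.Nat.Induction using (<-rec)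
import Data.Nat.ListAction as ℕ
import Data.Nat.ListAction.Properties as ℕ
import Data.Nat.Properties as ℕ
open import Data.Nat.Solver using (module +-*-Solver)
open import Data.Product using (∃; ∃₂; _×_; _,_; proj₁; proj₂)
open import Data.Rational as ℚ using (1ℚ)
import Data.Rational.Properties as ℚ
open import Data.Sum using (_⊎_; inj₁; inj₂)
open import Function using (_∘_)
open import Function.Bundles using (mk⇔)
open import Relation.Binary.Bundles using (Setoid)
open import Relation.Binary.Core using (_Preserves_⟶_)
open import Relation.Binary.Definitions
  using (DecidableEquality; _Respects_; Stable; tri<; tri≈; tri>)
open import Relation.Binary.PropositionalEquality as ≡ using (_≡_)
import Relation.Binary.Reasoning.Setoid
open import Relation.Binary.Structures using (IsEquivalence; IsStrictTotalOrder)
open import Relation.Nullary using (Dec; yes; no; ¬_; ¬?; contradiction)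
open import Relation.Nullary.Decidable using (_×-dec_; decidable-stable)
open import Relation.Unary using (Pred; Decidable)

infix 4 _≁_

_≁_ : ∀ {a} {A : Set a} → List A → List A → Set a
xs ≁ ys = ¬ (xs ↭ ys)

-- Formal sums, linear functionals on them, and the polynomial ring.

module PolynomialRing {a c ℓ : Level} (R : CommutativeRing c ℓ)
                      {Var : Set a} (_≟_ : DecidableEquality Var) where
  open CommutativeRing R hiding (zero)
  open Polynomials R _≟_ hiding (zero)
  open import Algebra.Properties.Ring ring using (-‿distribˡ-*; -0#≈0#)
  open import Algebra.Properties.AbelianGroup +-abelianGroup using (⁻¹-∙-comm)
  open import Algebra.Properties.CommutativeSemigroup +-commutativeSemigroup
    using (interchange; x∙yz≈y∙xz)
  open import Algebra.Properties.CommutativeSemigroup *-commutativeSemigroup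
    using () renaming (x∙yz≈y∙xz to x*yz≈y*xz)
  open Relation.Binary.Reasoning.Setoid setoid

  -- The linear extension of `φ` to formal sums. Polynomials are lists compared only through
  -- coefficients, so identities between them are proved by pairing with such functionals.
  lin : (Monomial → Carrier) → Polynomial → Carrier
  lin φ []            = 0#
  lin φ ((k , m) ∷ f) = k * φ m + lin φ f

  Invariant : (Monomial → Carrier) → Set _
  Invariant φ = φ Preserves _↭_ ⟶ _≈_

  coeff-hit : ∀ k {m′} f {m} → m′ ↭ m → coeff ((k , m′) ∷ f) m ≈ k + coeff f m
  coeff-hit k {m′} f {m} p with permutation? _≟_ m′ m
  ... | yes _ = refl
  ... | no ¬p = contradiction p ¬p

  coeff-miss : ∀ k {m′} f {m} → m′ ≁ m → coeff ((k , m′) ∷ f) m ≈ coeff f m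
  coeff-miss k {m′} f {m} ¬p with permutation? _≟_ m′ m
  ... | yes p = contradiction p ¬p
  ... | no _  = +-identityˡ _

  coeff-invariant : ∀ f → Invariant (coeff f)
  coeff-invariant []             p = refl
  coeff-invariant ((k , m″) ∷ f) {m} {m′} p with permutation? _≟_ m″ m
  ... | yes q = trans (+-congˡ (coeff-invariant f p)) (sym (coeff-hit k f (↭-trans q p)))
  ... | no ¬q = trans (+-identityˡ _) (trans (coeff-invariant f p)
                  (sym (coeff-miss k f λ q → ¬q (↭-trans q (↭-sym p)))))

  coeff-++ : ∀ f g m → coeff (f ++ g) m ≈ coeff f m + coeff g m
  coeff-++ []      g m = sym (+-identityˡ _)
  coeff-++ (_ ∷ f) g m = trans (+-congˡ (coeff-++ f g m)) (sym (+-assoc _ _ _))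

  coeff-absent : ∀ {m} f → All (λ (_ , m′) → m′ ≁ m) f → coeff f m ≈ 0#
  coeff-absent []            []       = refl
  coeff-absent ((k , _) ∷ f) (p ∷ ps) = trans (coeff-miss k f p) (coeff-absent f ps)

  -- The value at m′ of the functional "coefficient at m".
  δ : Monomial → Monomial → Carrier
  δ m m′ = coeff (monomial m′) m

  δ-hit : ∀ {m m′} → m′ ↭ m → δ m m′ ≈ 1#
  δ-hit p = trans (coeff-hit 1# [] p) (+-identityʳ 1#)

  δ-miss : ∀ {m m′} → m′ ≁ m → δ m m′ ≈ 0#
  δ-miss ¬p = coeff-miss 1# [] ¬p

  δ-invariant : ∀ m → Invariant (δ m)
  δ-invariant m {m′} {m″} p with permutation? _≟_ m″ m
  ... | yes q = trans (δ-hit (↭-trans p q)) (sym (+-identityʳ 1#))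
  ... | no ¬q = trans (δ-miss λ q → ¬q (↭-trans (↭-sym p) q)) (sym (+-identityʳ 0#))

  coeff≈lin : ∀ f m → coeff f m ≈ lin (δ m) f
  coeff≈lin []             m = refl
  coeff≈lin ((k , m′) ∷ f) m with permutation? _≟_ m′ m
  ... | yes _ = +-cong (sym (trans (*-congˡ (+-identityʳ 1#)) (*-identityʳ k))) (coeff≈lin f m)
  ... | no _  = +-cong (sym (trans (*-congˡ (+-identityʳ 0#)) (zeroʳ k))) (coeff≈lin f m)

  lin-++ : ∀ φ f g → lin φ (f ++ g) ≈ lin φ f + lin φ g
  lin-++ φ []            g = sym (+-identityˡ _)
  lin-++ φ ((k , m) ∷ f) g = trans (+-congˡ (lin-++ φ f g)) (sym (+-assoc _ _ _))

  lin-neg : ∀ φ f → lin φ (-ₚ f) ≈ - lin φ f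
  lin-neg φ []            = sym -0#≈0#
  lin-neg φ ((k , m) ∷ f) =
    trans (+-cong (sym (-‿distribˡ-* k (φ m))) (lin-neg φ f)) (⁻¹-∙-comm _ _)

  lin-cong : ∀ {φ ψ} → (∀ m → φ m ≈ ψ m) → ∀ f → lin φ f ≈ lin ψ f
  lin-cong e []            = refl
  lin-cong e ((k , m) ∷ f) = +-cong (*-congˡ (e m)) (lin-cong e f)

  lin-zero : ∀ f → lin (λ _ → 0#) f ≈ 0#
  lin-zero []      = refl
  lin-zero (_ ∷ f) = trans (+-cong (zeroʳ _) (lin-zero f)) (+-identityˡ 0#)

  lin-+ : ∀ φ ψ f → lin (λ m → φ m + ψ m) f ≈ lin φ f + lin ψ f
  lin-+ φ ψ []            = sym (+-identityˡ 0#)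
  lin-+ φ ψ ((k , m) ∷ f) =
    trans (+-cong (distribˡ k (φ m) (ψ m)) (lin-+ φ ψ f)) (interchange _ _ _ _)

  lin-* : ∀ k φ f → lin (λ m → k * φ m) f ≈ k * lin φ f
  lin-* k φ []             = sym (zeroʳ k)
  lin-* k φ ((k′ , m) ∷ f) =
    trans (+-cong (x*yz≈y*xz k′ k (φ m)) (lin-* k φ f)) (sym (distribˡ k _ _))

  lin-swap : ∀ (φ : Monomial → Monomial → Carrier) f g →
    lin (λ m → lin (φ m) g) f ≈ lin (λ m′ → lin (λ m → φ m m′) f) g
  lin-swap φ []            g = sym (lin-zero g)
  lin-swap φ ((k , m) ∷ f) g = begin
    k * lin (φ m) g + lin (λ m → lin (φ m) g) f
      ≈⟨ +-cong (sym (lin-* k (φ m) g)) (lin-swap φ f g) ⟩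
    lin (λ m′ → k * φ m m′) g + lin (λ m′ → lin (λ m → φ m m′) f) g
      ≈⟨ lin-+ _ _ g ⟨
    lin (λ m′ → k * φ m m′ + lin (λ m → φ m m′) f) g ∎

  module _ {p} {P : Pred Monomial p} (P? : Decidable P) where

    restrict : Polynomial → Polynomial
    restrict = filter (P? ∘ proj₂)

    coeff-restrict : P Respects _↭_ → ∀ f {m} → P m → coeff (restrict f) m ≈ coeff f m
    coeff-restrict resp []             Pm = refl
    coeff-restrict resp ((k , m′) ∷ f) {m} Pm with P? m′ | permutation? _≟_ m′ m
    ... | yes _  | yes m′↭m = trans (coeff-hit k (restrict f) m′↭m)
                                (+-congˡ (coeff-restrict resp f Pm))
    ... | yes _  | no m′≁m  = trans (coeff-miss k (restrict f) m′≁m)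
                                (trans (coeff-restrict resp f Pm) (sym (+-identityˡ _)))
    ... | no ¬Pm′ | yes m′↭m = contradiction (resp (↭-sym m′↭m) Pm) ¬Pm′
    ... | no _    | no _     = trans (coeff-restrict resp f Pm) (sym (+-identityˡ _))

    coeff-restrict-reject : P Respects _↭_ → ∀ f {m} → ¬ P m → coeff (restrict f) m ≈ 0#
    coeff-restrict-reject resp f ¬Pm =
      coeff-absent (restrict f)
        (All.map (λ Pm′ m′↭m → ¬Pm (resp m′↭m Pm′)) (All.all-filter (P? ∘ proj₂) f))

  delete : Monomial → Polynomial → Polynomial
  delete m = restrict (λ m′ → ¬? (permutation? _≟_ m′ m))

  ≁-resp : ∀ (m : Monomial) → (_≁ m) Respects _↭_
  ≁-resp m p m′≁m q = m′≁m (↭-trans p q)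

  -- Collecting like terms: those carrying `m` may be scattered over the list, but `φ` agrees on all
  -- of them, so together they contribute their total coefficient times `φ m`.
  lin-delete : ∀ {φ} → Invariant φ → ∀ m f →
    lin φ f ≈ coeff f m * φ m + lin φ (delete m f)
  lin-delete {φ} inv m [] = sym (trans (+-identityʳ _) (zeroˡ (φ m)))
  lin-delete {φ} inv m ((k , m′) ∷ f) with permutation? _≟_ m′ m
  ... | yes m′↭m = begin
    k * φ m′ + lin φ f
      ≈⟨ +-cong (*-congˡ (inv m′↭m)) (lin-delete inv m f) ⟩
    k * φ m + (coeff f m * φ m + lin φ (delete m f))
      ≈⟨ +-assoc _ _ _ ⟨
    k * φ m + coeff f m * φ m + lin φ (delete m f)
      ≈⟨ +-congʳ (distribʳ (φ m) k _) ⟨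
    (k + coeff f m) * φ m + lin φ (delete m f) ∎
  ... | no _ = begin
    k * φ m′ + lin φ f
      ≈⟨ +-congˡ (lin-delete inv m f) ⟩
    k * φ m′ + (coeff f m * φ m + lin φ (delete m f))
      ≈⟨ x∙yz≈y∙xz _ _ _ ⟩
    coeff f m * φ m + (k * φ m′ + lin φ (delete m f))
      ≈⟨ +-congʳ (*-congʳ (+-identityˡ _)) ⟨
    (0# + coeff f m) * φ m + (k * φ m′ + lin φ (delete m f)) ∎

  -- The total coefficient is meant, since single terms may cancel one another.
  VanishesOn : (Monomial → Carrier) → Polynomial → Set _
  VanishesOn φ f = All (λ (_ , m) → coeff f m ≈ 0# ⊎ φ m ≈ 0#) f

  vanishesOn-delete : ∀ φ m f →
    All (λ (_ , m′) → m′ ≁ m → coeff f m′ ≈ 0# ⊎ φ m′ ≈ 0#) f →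
    VanishesOn φ (delete m f)
  vanishesOn-delete φ m f h = All.zipWith (λ {t} → step {t})
    (All.all-filter (apart? ∘ proj₂) f , All.filter⁺ (apart? ∘ proj₂) h)
    where
    apart? : Decidable (_≁ m)
    apart? m′ = ¬? (permutation? _≟_ m′ m)
    step : ∀ {t : Carrier × Monomial} →
           (proj₂ t ≁ m) × (proj₂ t ≁ m → coeff f (proj₂ t) ≈ 0# ⊎ φ (proj₂ t) ≈ 0#) →
           coeff (delete m f) (proj₂ t) ≈ 0# ⊎ φ (proj₂ t) ≈ 0#
    step (m′≁m , h) with h m′≁m
    ... | inj₁ z = inj₁ (trans (coeff-restrict apart? (≁-resp m) f m′≁m) z)
    ... | inj₂ z = inj₂ z

  *-zero : ∀ {x y} → x ≈ 0# ⊎ y ≈ 0# → x * y ≈ 0#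
  *-zero (inj₁ x≈0) = trans (*-congʳ x≈0) (zeroˡ _)
  *-zero (inj₂ y≈0) = trans (*-congˡ y≈0) (zeroʳ _)

  -- Collecting the terms like the first one removes at least that one, possibly more, hence
  -- induction on a bound for the length rather than on the list.
  lin-vanish : ∀ {φ} → Invariant φ → ∀ f → VanishesOn φ f → lin φ f ≈ 0#
  lin-vanish {φ} inv f = bounded (length f) f ℕ.≤-refl
    where
    bounded : ∀ n f → length f ℕ.≤ n → VanishesOn φ f → lin φ f ≈ 0#
    bounded n       []                 _    _       = refl
    bounded (suc n) f@((k , m) ∷ f′) f≤n (h ∷ hs) = begin
      lin φ f
        ≈⟨ lin-delete inv m f ⟩
      coeff f m * φ m + lin φ (delete m f)
        ≈⟨ +-cong (*-zero h) (bounded n (delete m f) shorter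
             (vanishesOn-delete φ m f (All.map (λ h _ → h) (h ∷ hs)))) ⟩
      0# + 0#
        ≈⟨ +-identityˡ 0# ⟩
      0# ∎
      where
      shorter : length (delete m f) ℕ.≤ n
      shorter = s≤s⁻¹ (ℕ.≤-trans
        (filter-notAll (λ (_ , m′) → ¬? (permutation? _≟_ m′ m)) f (here λ m≁m → m≁m ↭-refl)) f≤n)

  lin-single : ∀ {φ} → Invariant φ → ∀ m f →
    All (λ (_ , m′) → m′ ≁ m → coeff f m′ ≈ 0# ⊎ φ m′ ≈ 0#) f →
    lin φ f ≈ coeff f m * φ m
  lin-single {φ} inv m f h = trans (lin-delete inv m f)
    (trans (+-congˡ (lin-vanish inv (delete m f) (vanishesOn-delete φ m f h))) (+-identityʳ _))

  coeff-neg : ∀ f m → coeff (-ₚ f) m ≈ - coeff f m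
  coeff-neg f m = trans (coeff≈lin (-ₚ f) m)
    (trans (lin-neg (δ m) f) (-‿cong (sym (coeff≈lin f m))))

  -- Invariant functionals are well defined on polynomials: all coefficients of `f -ₚ g` are zero,
  -- so the functional vanishes there.
  lin-congₚ : ∀ {φ f g} → Invariant φ → f ≈ₚ g → lin φ f ≈ lin φ g
  lin-congₚ {φ} {f} {g} inv f≈g = x-y≈0⇒x≈y (begin
    lin φ f - lin φ g       ≈⟨ +-congˡ (lin-neg φ g) ⟨
    lin φ f + lin φ (-ₚ g)  ≈⟨ lin-++ φ f (-ₚ g) ⟨
    lin φ (f -ₚ g)          ≈⟨ lin-vanish inv (f -ₚ g) (All.tabulate λ _ → inj₁ (difference _)) ⟩
    0# ∎)
    where
    open import Algebra.Properties.Group +-group using () renaming (x∙y⁻¹≈ε⇒x≈y to cancel)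
    x-y≈0⇒x≈y : ∀ {x y} → x - y ≈ 0# → x ≈ y
    x-y≈0⇒x≈y = cancel _ _
    difference : ∀ m → coeff (f -ₚ g) m ≈ 0#
    difference m = begin
      coeff (f -ₚ g) m            ≈⟨ coeff-++ f (-ₚ g) m ⟩
      coeff f m + coeff (-ₚ g) m  ≈⟨ +-cong (f≈g m) (coeff-neg g m) ⟩
      coeff g m - coeff g m       ≈⟨ -‿inverseʳ _ ⟩
      0# ∎

  lin-*ₚ : ∀ φ f g → lin φ (f *ₚ g) ≈ lin (λ m → lin (λ m′ → φ (m ++ m′)) g) f
  lin-*ₚ φ []            g = refl
  lin-*ₚ φ ((k , m) ∷ f) g = begin
    lin φ (map shifted g ++ f *ₚ g)           ≈⟨ lin-++ φ (map shifted g) (f *ₚ g) ⟩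
    lin φ (map shifted g) + lin φ (f *ₚ g)    ≈⟨ +-cong (lin-shifted g) (lin-*ₚ φ f g) ⟩
    k * lin (λ m′ → φ (m ++ m′)) g + lin (λ m → lin (λ m′ → φ (m ++ m′)) g) f ∎
    where
    shifted = λ (t : Carrier × Monomial) → let (k′ , m′) = t in (k * k′) , (m ++ m′)
    lin-shifted : ∀ g → lin φ (map shifted g) ≈ k * lin (λ m′ → φ (m ++ m′)) g
    lin-shifted []              = sym (zeroʳ k)
    lin-shifted ((k′ , m′) ∷ g) =
      trans (+-cong (*-assoc k k′ _) (lin-shifted g)) (sym (distribˡ k _ _))

  ++-invariantˡ : ∀ {φ} → Invariant φ → ∀ m → Invariant (λ m′ → φ (m ++ m′))
  ++-invariantˡ inv m p = inv (++⁺ˡ m p)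

  ++-invariantʳ : ∀ {φ} → Invariant φ → ∀ g → Invariant (λ m → lin (λ m′ → φ (m ++ m′)) g)
  ++-invariantʳ inv g p = lin-cong (λ m′ → inv (++⁺ʳ m′ p)) g

  -- Coefficients are invariant functionals, so a ring law may be checked against an arbitrary
  -- invariant `φ`, for which a product becomes a double sum.
  ≈ₚ-by-lin : ∀ f g → (∀ {φ} → Invariant φ → lin φ f ≈ lin φ g) → f ≈ₚ g
  ≈ₚ-by-lin f g e m =
    trans (coeff≈lin f m) (trans (e (δ-invariant m)) (sym (coeff≈lin g m)))

  +ₚ-cong : ∀ {f f′ g g′} → f ≈ₚ f′ → g ≈ₚ g′ → f +ₚ g ≈ₚ f′ +ₚ g′
  +ₚ-cong {f} {f′} {g} {g′} f≈ g≈ m =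
    trans (coeff-++ f g m) (trans (+-cong (f≈ m) (g≈ m)) (sym (coeff-++ f′ g′ m)))

  *ₚ-cong : ∀ {f f′ g g′} → f ≈ₚ f′ → g ≈ₚ g′ → f *ₚ g ≈ₚ f′ *ₚ g′
  *ₚ-cong {f} {f′} {g} {g′} f≈ g≈ = ≈ₚ-by-lin (f *ₚ g) (f′ *ₚ g′) λ {φ} inv → begin
    lin φ (f *ₚ g)
      ≈⟨ lin-*ₚ φ f g ⟩
    lin (λ m → lin (λ m′ → φ (m ++ m′)) g) f
      ≈⟨ lin-congₚ {f = f} {f′} (++-invariantʳ inv g) f≈ ⟩
    lin (λ m → lin (λ m′ → φ (m ++ m′)) g) f′
      ≈⟨ lin-cong (λ m → lin-congₚ {f = g} {g′} (++-invariantˡ inv m) g≈) f′ ⟩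
    lin (λ m → lin (λ m′ → φ (m ++ m′)) g′) f′
      ≈⟨ lin-*ₚ φ f′ g′ ⟨
    lin φ (f′ *ₚ g′) ∎

  *ₚ-assoc : ∀ f g h → (f *ₚ g) *ₚ h ≈ₚ f *ₚ (g *ₚ h)
  *ₚ-assoc f g h = ≈ₚ-by-lin ((f *ₚ g) *ₚ h) (f *ₚ (g *ₚ h)) λ {φ} inv → begin
    lin φ ((f *ₚ g) *ₚ h)
      ≈⟨ lin-*ₚ φ (f *ₚ g) h ⟩
    lin (λ m → lin (λ m″ → φ (m ++ m″)) h) (f *ₚ g)
      ≈⟨ lin-*ₚ _ f g ⟩
    lin (λ m → lin (λ m′ → lin (λ m″ → φ ((m ++ m′) ++ m″)) h) g) f
      ≈⟨ lin-cong (λ m → lin-cong (λ m′ → lin-cong (λ m″ →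
           inv (↭-reflexive (++-assoc m m′ m″))) h) g) f ⟩
    lin (λ m → lin (λ m′ → lin (λ m″ → φ (m ++ (m′ ++ m″))) h) g) f
      ≈⟨ lin-cong (λ m → lin-*ₚ (λ m′ → φ (m ++ m′)) g h) f ⟨
    lin (λ m → lin (λ m′ → φ (m ++ m′)) (g *ₚ h)) f
      ≈⟨ lin-*ₚ φ f (g *ₚ h) ⟨
    lin φ (f *ₚ (g *ₚ h)) ∎

  *ₚ-comm : ∀ f g → f *ₚ g ≈ₚ g *ₚ f
  *ₚ-comm f g = ≈ₚ-by-lin (f *ₚ g) (g *ₚ f) λ {φ} inv → begin
    lin φ (f *ₚ g)
      ≈⟨ lin-*ₚ φ f g ⟩
    lin (λ m → lin (λ m′ → φ (m ++ m′)) g) f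
      ≈⟨ lin-swap (λ m m′ → φ (m ++ m′)) f g ⟩
    lin (λ m′ → lin (λ m → φ (m ++ m′)) f) g
      ≈⟨ lin-cong (λ m′ → lin-cong (λ m → inv (++-comm m m′)) f) g ⟩
    lin (λ m′ → lin (λ m → φ (m′ ++ m)) f) g
      ≈⟨ lin-*ₚ φ g f ⟨
    lin φ (g *ₚ f) ∎

  lin-constant : ∀ φ k f → lin φ (constant k *ₚ f) ≈ k * lin φ f
  lin-constant φ k f = trans (lin-*ₚ φ (constant k) f) (+-identityʳ _)

  coeff-constant : ∀ k f m → coeff (constant k *ₚ f) m ≈ k * coeff f m
  coeff-constant k f m = trans (coeff≈lin (constant k *ₚ f) m)
    (trans (lin-constant (δ m) k f) (*-congˡ (sym (coeff≈lin f m))))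

  *ₚ-identityˡ : ∀ f → constant 1# *ₚ f ≈ₚ f
  *ₚ-identityˡ f m = trans (coeff-constant 1# f m) (*-identityˡ _)

  *ₚ-distribʳ : ∀ h f g → (f +ₚ g) *ₚ h ≈ₚ f *ₚ h +ₚ g *ₚ h
  *ₚ-distribʳ h f g = ≈ₚ-by-lin ((f +ₚ g) *ₚ h) (f *ₚ h +ₚ g *ₚ h) λ {φ} _ → begin
    lin φ ((f +ₚ g) *ₚ h)                ≈⟨ lin-*ₚ φ (f +ₚ g) h ⟩
    lin (inner φ) (f +ₚ g)               ≈⟨ lin-++ (inner φ) f g ⟩
    lin (inner φ) f + lin (inner φ) g    ≈⟨ +-cong (lin-*ₚ φ f h) (lin-*ₚ φ g h) ⟨
    lin φ (f *ₚ h) + lin φ (g *ₚ h)      ≈⟨ lin-++ φ (f *ₚ h) (g *ₚ h) ⟨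
    lin φ (f *ₚ h +ₚ g *ₚ h) ∎
    where
    inner : (Monomial → Carrier) → Monomial → Carrier
    inner φ m = lin (λ m′ → φ (m ++ m′)) h

  polynomialRing : CommutativeRing _ _
  polynomialRing = record
    { Carrier = Polynomial ; _≈_ = _≈ₚ_ ; _+_ = _+ₚ_ ; _*_ = _*ₚ_ ; -_ = -ₚ_
    ; 0# = 0ₚ ; 1# = constant 1#
    ; isCommutativeRing = record
      { isRing = record
        { +-isAbelianGroup = record
          { isGroup = record
            { isMonoid = record
              { isSemigroup = record
                { isMagma = record
                  { isEquivalence = isEquivalenceₚ
                  ; ∙-cong = λ {f} {f′} {g} {g′} → +ₚ-cong {f} {f′} {g} {g′} }
                ; assoc = λ f g h m → reflexive (≡.cong (λ p → coeff p m) (++-assoc f g h)) }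
              ; identity = comm∧idˡ⇒id {_∙_ = _+ₚ_} +ₚ-comm {e = 0ₚ} (λ f m → refl) }
            ; inverse = comm∧invˡ⇒inv {_∙_ = _+ₚ_} {_⁻¹ = -ₚ_} {e = 0ₚ} +ₚ-comm λ f m →
                trans (coeff-++ (-ₚ f) f m)
                  (trans (+-congʳ (coeff-neg f m)) (-‿inverseˡ (coeff f m)))
            ; ⁻¹-cong = λ {f} {g} f≈g m →
                trans (coeff-neg f m) (trans (-‿cong (f≈g m)) (sym (coeff-neg g m))) }
          ; comm = +ₚ-comm }
        ; *-cong = λ {f} {f′} {g} {g′} → *ₚ-cong {f} {f′} {g} {g′}
        ; *-assoc = *ₚ-assoc
        ; *-identity = comm∧idˡ⇒id {_∙_ = _*ₚ_} *ₚ-comm {e = constant 1#} *ₚ-identityˡ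
        ; distrib = comm∧distrʳ⇒distr {_∙_ = _*ₚ_} {_◦_ = _+ₚ_}
            (λ {f} {f′} {g} {g′} → +ₚ-cong {f} {f′} {g} {g′}) *ₚ-comm *ₚ-distribʳ }
      ; *-comm = *ₚ-comm } }
    where
    isEquivalenceₚ : IsEquivalence _≈ₚ_
    isEquivalenceₚ = record
      { refl  = λ m → refl
      ; sym   = λ f≈g m → sym (f≈g m)
      ; trans = λ f≈g g≈h m → trans (f≈g m) (g≈h m) }
    polynomialSetoid : Setoid _ _
    polynomialSetoid = record { isEquivalence = isEquivalenceₚ }
    open import Algebra.Consequences.Setoid polynomialSetoid
      using (comm∧idˡ⇒id; comm∧invˡ⇒inv; comm∧distrʳ⇒distr)
    +ₚ-comm : ∀ f g → f +ₚ g ≈ₚ g +ₚ f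
    +ₚ-comm f g m = trans (coeff-++ f g m) (trans (+-comm _ _) (sym (coeff-++ g f m)))

-- Combinatorics of non-crossing monomials.

∈-∃↭ : ∀ {a} {A : Set a} {x : A} {xs} → x ∈ xs → ∃ λ ys → xs ↭ x ∷ ys
∈-∃↭ x∈xs with ys , zs , ≡.refl ← ∈-∃++ x∈xs = ys ++ zs , shift _ ys zs

module NonCrossingMonomials {n : ℕ} where
  open ≡ using (refl; cong; subst; subst₂)
  open _↭_

  index-ext : {J K : Index n} → j₁ J ≡ j₁ K → j₂ J ≡ j₂ K → J ≡ K
  index-ext {index i j p} {index .i .j q} refl refl = cong (index i j) (ℕ.<-irrelevant p q)

  entries : Index n → List (Entry n)
  entries J = (Fin.zero , j₁ J) ∷ (Fin.suc Fin.zero , j₂ J) ∷ []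

  -- The product of the main-diagonal terms of the minors. It records opening columns in row 0 and
  -- closing columns in row 1, forgetting how they are paired.
  diagonal : List (Index n) → List (Entry n)
  diagonal []      = []
  diagonal (J ∷ M) = entries J ++ diagonal M

  diagonal-↭ : ∀ {M N} → M ↭ N → diagonal M ↭ diagonal N
  diagonal-↭ refl         = ↭-refl
  diagonal-↭ (prep J p)   = ++⁺ˡ (entries J) (diagonal-↭ p)
  diagonal-↭ (swap J K p) = ↭-trans (shifts (entries J) (entries K))
    (++⁺ˡ (entries K) (++⁺ˡ (entries J) (diagonal-↭ p)))
  diagonal-↭ (trans p q)  = ↭-trans (diagonal-↭ p) (diagonal-↭ q)

  opener∈ : ∀ {J M} → J ∈ M → (Fin.zero , j₁ J) ∈ diagonal M
  opener∈ (here refl) = here refl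
  opener∈ (there J∈M) = there (there (opener∈ J∈M))

  closer∈ : ∀ {J M} → J ∈ M → (Fin.suc Fin.zero , j₂ J) ∈ diagonal M
  closer∈ (here refl) = there (here refl)
  closer∈ (there J∈M) = there (there (closer∈ J∈M))

  ∈opener : ∀ {i} M → (Fin.zero , i) ∈ diagonal M → ∃ λ J → J ∈ M × j₁ J ≡ i
  ∈opener (J ∷ M) (here refl) = J , here refl , refl
  ∈opener (J ∷ M) (there (there i∈)) with K , K∈ , e ← ∈opener M i∈ = K , there K∈ , e

  ∈closer : ∀ {i} M → (Fin.suc Fin.zero , i) ∈ diagonal M → ∃ λ J → J ∈ M × j₂ J ≡ i
  ∈closer (J ∷ M) (there (here refl)) = J , here refl , refl
  ∈closer (J ∷ M) (there (there i∈)) with K , K∈ , e ← ∈closer M i∈ = K , there K∈ , e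

  -- In the bracketing picture the first closing bracket is matched with the
  -- last opening bracket before it.
  record Innermost (J : Index n) (M : List (Index n)) : Set where
    field
      member       : J ∈ M
      first-closer : ∀ {K} → K ∈ M → j₂ J Fin.≤ j₂ K
      last-opener  : ∀ {K} → K ∈ M → j₁ K Fin.< j₂ J → j₁ K Fin.≤ j₁ J
  open Innermost

  innermost : ∀ J M → NonCrossing (J ∷ M) → ∃ λ K → Innermost K (J ∷ M)
  innermost J [] nc = J , record
    { member = here refl
    ; first-closer = λ { (here refl) → ℕ.≤-refl }
    ; last-opener = λ { (here refl) _ → ℕ.≤-refl } }
  innermost J (K ∷ M) nc with innermost K M (λ p q → nc (there p) (there q))
  ... | L , inn with Fin.<-cmp (j₂ J) (j₂ L) | j₁ J Fin.<? j₁ L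
  -- A pair opening after `J` and before `J` closes would close later than `J`, and so be crossed by
  -- it.
  ... | tri< J<L _ _ | _ = J , record
    { member = here refl
    ; first-closer = λ { (here refl) → ℕ.≤-refl
                       ; (there p) → ℕ.≤-trans (ℕ.<⇒≤ J<L) (first-closer inn p) }
    ; last-opener = λ { (here refl) _ → ℕ.≤-refl
                      ; (there p) lt → ℕ.≮⇒≥ λ gt → nc (here refl) (there p)
                          (gt , lt , ℕ.<-≤-trans J<L (first-closer inn p)) } }
  -- Among pairs with the same closing column the later opener is kept.
  ... | tri≈ _ refl _ | yes lt = L , record
    { member = there (member inn)
    ; first-closer = λ { (here refl) → ℕ.≤-refl ; (there p) → first-closer inn p }
    ; last-opener = λ { (here refl) _ → ℕ.<⇒≤ lt ; (there p) → last-opener inn p } }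
  ... | tri≈ _ refl _ | no ¬lt = J , record
    { member = here refl
    ; first-closer = λ { (here refl) → ℕ.≤-refl ; (there p) → first-closer inn p }
    ; last-opener = λ { (here refl) _ → ℕ.≤-refl
                      ; (there p) lt → ℕ.≤-trans (last-opener inn p lt) (ℕ.≮⇒≥ ¬lt) } }
  ... | tri> _ _ L<J | _ = L , record
    { member = there (member inn)
    ; first-closer = λ { (here refl) → ℕ.<⇒≤ L<J ; (there p) → first-closer inn p }
    ; last-opener = λ { (here refl) lt → ℕ.≮⇒≥ λ gt →
                          nc (there (member inn)) (here refl) (gt , lt , L<J)
                      ; (there p) → last-opener inn p } }

  -- The closing column of `K` is a row 1 entry of the common diagonal, so some pair of `M` closes
  -- there, and `J` closes no later than that pair.
  innermost-closer-≤ : ∀ {J K M N} → Innermost J M → Innermost K N → diagonal M ↭ diagonal N →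
    j₂ J Fin.≤ j₂ K
  innermost-closer-≤ {M = M} a b p
    with L , L∈ , refl ← ∈closer M (∈-resp-↭ (↭-sym p) (closer∈ (member b))) = first-closer a L∈

  innermost-opener-≤ : ∀ {J K M N} → Innermost J M → Innermost K N → diagonal M ↭ diagonal N →
    j₂ J ≡ j₂ K → j₁ K Fin.≤ j₁ J
  innermost-opener-≤ {J} {K} {M} a b p e
    with L , L∈ , eq ← ∈opener M (∈-resp-↭ (↭-sym p) (opener∈ (member b))) =
    subst (Fin._≤ j₁ J) eq (last-opener a L∈ (subst₂ Fin._<_ (≡.sym eq) (≡.sym e) (j₁<j₂ K)))

  innermost-unique : ∀ {J K M N} → Innermost J M → Innermost K N → diagonal M ↭ diagonal N → J ≡ K
  innermost-unique a b p = index-ext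
    (Fin.≤-antisym (innermost-opener-≤ b a (↭-sym p) (≡.sym closers))
                   (innermost-opener-≤ a b p closers))
    closers
    where
    closers = Fin.≤-antisym (innermost-closer-≤ a b p) (innermost-closer-≤ b a (↭-sym p))

  nonCrossing-↭ : ∀ {M N : List (Index n)} → M ↭ N → NonCrossing M → NonCrossing N
  nonCrossing-↭ p nc J∈ K∈ = nc (∈-resp-↭ (↭-sym p) J∈) (∈-resp-↭ (↭-sym p) K∈)

  -- The innermost pair can be read off the diagonal, so both monomials contain the same one, and
  -- removing it keeps the diagonals equal. It need not be the head of the list, hence induction on
  -- a bound for the length.
  diagonal-injective : ∀ M N → NonCrossing M → NonCrossing N → diagonal M ↭ diagonal N → M ↭ N
  diagonal-injective M N = bounded (length M) M N ℕ.≤-refl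
    where
    bounded : ∀ l M N → length M ℕ.≤ l → NonCrossing M → NonCrossing N →
              diagonal M ↭ diagonal N → M ↭ N
    bounded l [] []      _ _ _ _ = ↭-refl
    bounded l [] (K ∷ N) _ _ _ p = contradiction (↭-empty-inv (↭-sym p)) λ ()
    bounded l (J ∷ M) [] _ _ _ p = contradiction (↭-empty-inv p) λ ()
    bounded (suc l) (J ∷ M) (K ∷ N) ≤l ncM ncN p
      with L  , innM ← innermost J M ncM | L′ , innN ← innermost K N ncN
      with refl ← innermost-unique innM innN p
      with M′ , pM ← ∈-∃↭ (member innM) | N′ , pN ← ∈-∃↭ (member innN) =
      ↭-trans pM (↭-trans (prep L rest) (↭-sym pN))
      where
      rest : M′ ↭ N′
      rest = bounded l M′ N′ (s≤s⁻¹ (subst (ℕ._≤ suc l) (↭-length pM) ≤l))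
        (λ p q → nonCrossing-↭ pM ncM (there p) (there q))
        (λ p q → nonCrossing-↭ pN ncN (there p) (there q))
        (drop-∷ (drop-∷ (↭-trans (diagonal-↭ (↭-sym pM)) (↭-trans p (diagonal-↭ pN)))))

  crosses? : ∀ (J K : Index n) → Dec (Crosses J K)
  crosses? J K = (j₁ J Fin.<? j₁ K) ×-dec (j₁ K Fin.<? j₂ J) ×-dec (j₂ J Fin.<? j₂ K)

  crossing-pair : ∀ M → NonCrossing M ⊎ ∃₂ λ J K → J ∈ M × K ∈ M × Crosses {n} J K
  crossing-pair M with any? (λ J → any? (crosses? J) M) M
  ... | no ¬p = inj₁ λ J∈ K∈ c → ¬p (lose J∈ (lose K∈ c))
  ... | yes p with J , J∈ , q ← find p with K , K∈ , c ← find q = inj₂ (J , K , J∈ , K∈ , c)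

  crosses-↭ : ∀ {M} {J K : Index n} → J ∈ M → K ∈ M → Crosses J K → ∃ λ N → M ↭ J ∷ K ∷ N
  crosses-↭ {J = J} J∈ K∈ c with M′ , p ← ∈-∃↭ J∈ with ∈-resp-↭ p K∈
  -- A pair does not cross itself, so `K` lies among the remaining factors.
  ... | here refl = contradiction (proj₁ c) (ℕ.<-irrefl refl)
  ... | there K∈M′ with N , q ← ∈-∃↭ K∈M′ = N , ↭-trans p (prep J q)

  weight-↭ : ∀ {M N : List (Index n)} → M ↭ N → weight M ≡ weight N
  weight-↭ p = ℕ.product-↭ (Perm.map⁺ weightᴵ p)

  weightᴵ>0 : ∀ (J : Index n) → 0 ℕ.< weightᴵ J
  weightᴵ>0 J = ℕ.m<n⇒0<n∸m (j₁<j₂ J)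

  weight>0 : ∀ (M : List (Index n)) → 0 ℕ.< weight M
  weight>0 []      = ℕ.≤-refl
  weight>0 (J ∷ M) = ℕ.*-mono-≤ (weightᴵ>0 J) (weight>0 M)

  weight-pair-< : ∀ {J K J′ K′ : Index n} N →
    weightᴵ J′ ℕ.* weightᴵ K′ ℕ.< weightᴵ J ℕ.* weightᴵ K →
    weight (J′ ∷ K′ ∷ N) ℕ.< weight (J ∷ K ∷ N)
  weight-pair-< {J} {K} {J′} {K′} N lt = subst₂ ℕ._<_
    (ℕ.*-assoc (weightᴵ J′) _ _) (ℕ.*-assoc (weightᴵ J) _ _)
    (ℕ.*-monoˡ-< (weight N) {{ℕ.>-nonZero (weight>0 N)}} lt)

-- Ptolemy's identity for gaps and the three-term Plücker relation.

∸-split : ∀ {a b c} → a ℕ.≤ b → b ℕ.≤ c → c ℕ.∸ a ≡ (b ℕ.∸ a) ℕ.+ (c ℕ.∸ b)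
∸-split {a} {b} {c} a≤b b≤c = ≡.trans (≡.cong (ℕ._∸ a) (≡.sym (ℕ.m+[n∸m]≡n b≤c)))
  (ℕ.+-∸-comm (c ℕ.∸ b) a≤b)

-- By Ptolemy's identity for four points on a line, each uncrossed product falls short of the
-- crossing one by the other uncrossed product, which is positive.
∸-uncross : ∀ {a b c d} → a ℕ.< b → b ℕ.< c → c ℕ.< d →
  ((b ℕ.∸ a) ℕ.* (d ℕ.∸ c) ℕ.< (c ℕ.∸ a) ℕ.* (d ℕ.∸ b)) ×
  ((d ℕ.∸ a) ℕ.* (c ℕ.∸ b) ℕ.< (c ℕ.∸ a) ℕ.* (d ℕ.∸ b))
∸-uncross {a} {b} {c} {d} a<b b<c c<d
  rewrite ∸-split (ℕ.<⇒≤ a<b) (ℕ.<⇒≤ (ℕ.<-trans b<c c<d))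
        | ∸-split (ℕ.<⇒≤ a<b) (ℕ.<⇒≤ b<c)
        | ∸-split (ℕ.<⇒≤ b<c) (ℕ.<⇒≤ c<d)
  = ≡.subst (x ℕ.* z ℕ.<_) (≡.sym (ptolemy x y z)) (ℕ.m<m+n _ (ℕ.*-mono-≤ 0<x+y+z 0<y))
  , ≡.subst ((x ℕ.+ (y ℕ.+ z)) ℕ.* y ℕ.<_) (≡.sym (ptolemy x y z)) (ℕ.m<n+m _ (ℕ.*-mono-≤ 0<x 0<z))
  where
  x = b ℕ.∸ a
  y = c ℕ.∸ b
  z = d ℕ.∸ c
  0<x = ℕ.m<n⇒0<n∸m a<b
  0<y = ℕ.m<n⇒0<n∸m b<c
  0<z = ℕ.m<n⇒0<n∸m c<d
  0<x+y+z : 0 ℕ.< x ℕ.+ (y ℕ.+ z)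
  0<x+y+z = ℕ.<-≤-trans 0<x (ℕ.m≤m+n x _)
  ptolemy : ∀ x y z →
    (x ℕ.+ y) ℕ.* (y ℕ.+ z) ≡ x ℕ.* z ℕ.+ (x ℕ.+ (y ℕ.+ z)) ℕ.* y
  ptolemy = solve 3 (λ x y z →
    (x :+ y) :* (y :+ z) := x :* z :+ (x :+ (y :+ z)) :* y) ≡.refl
    where open +-*-Solver

module _ {c ℓ : Level} (S : CommutativeRing c ℓ) where
  open CommutativeRing S
  private
    module Solver = Algebra.Solver.Ring.NaturalCoefficients.Default commutativeSemiring
    open import Algebra.Properties.Ring ring using (-1*x≈-x)
    open Relation.Binary.Reasoning.Setoid setoid

  det : Carrier → Carrier → Carrier → Carrier → Carrier
  det x₀ x₁ y₀ y₁ = x₀ * y₁ - y₀ * x₁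

  plücker : ∀ a₀ a₁ b₀ b₁ c₀ c₁ d₀ d₁ →
    det a₀ a₁ c₀ c₁ * det b₀ b₁ d₀ d₁
      ≈ det a₀ a₁ b₀ b₁ * det c₀ c₁ d₀ d₁ + det a₀ a₁ d₀ d₁ * det b₀ b₁ c₀ c₁
  plücker a₀ a₁ b₀ b₁ c₀ c₁ d₀ d₁ = begin
    det a₀ a₁ c₀ c₁ * det b₀ b₁ d₀ d₁
      ≈⟨ *-cong (det≈ a₀ a₁ c₀ c₁) (det≈ b₀ b₁ d₀ d₁) ⟩
    det′ a₀ a₁ c₀ c₁ * det′ b₀ b₁ d₀ d₁
      ≈⟨ trans (+-congˡ (trans (+-congˡ (-1*x≈-x t)) (-‿inverseʳ t))) (+-identityʳ _) ⟨
    det′ a₀ a₁ c₀ c₁ * det′ b₀ b₁ d₀ d₁ + (t + m * t)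
      ≈⟨ identity m a₀ a₁ b₀ b₁ c₀ c₁ d₀ d₁ ⟩
    det′ a₀ a₁ b₀ b₁ * det′ c₀ c₁ d₀ d₁ + det′ a₀ a₁ d₀ d₁ * det′ b₀ b₁ c₀ c₁
      ≈⟨ +-cong (*-cong (det≈ a₀ a₁ b₀ b₁) (det≈ c₀ c₁ d₀ d₁))
                (*-cong (det≈ a₀ a₁ d₀ d₁) (det≈ b₀ b₁ c₀ c₁)) ⟨
    det a₀ a₁ b₀ b₁ * det c₀ c₁ d₀ d₁ + det a₀ a₁ d₀ d₁ * det b₀ b₁ c₀ c₁ ∎
    where
    -- The solver knows no negation, so - 1# is passed to it as a variable m.
    m = - 1#
    -- For a free variable `m` the right side exceeds the left by exactly `t + m * t`, which is zero
    -- once `m` is `- 1#`.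
    t = a₀ * b₁ * c₀ * d₁ + m * (b₀ * a₁ * d₀ * c₁)
    det′ : Carrier → Carrier → Carrier → Carrier → Carrier
    det′ x₀ x₁ y₀ y₁ = x₀ * y₁ + m * (y₀ * x₁)
    det≈ : ∀ x₀ x₁ y₀ y₁ → det x₀ x₁ y₀ y₁ ≈ det′ x₀ x₁ y₀ y₁
    det≈ x₀ x₁ y₀ y₁ = +-congˡ (sym (-1*x≈-x _))
    identity : ∀ m a₀ a₁ b₀ b₁ c₀ c₁ d₀ d₁ →
      (a₀ * c₁ + m * (c₀ * a₁)) * (b₀ * d₁ + m * (d₀ * b₁))
        + (a₀ * b₁ * c₀ * d₁ + m * (b₀ * a₁ * d₀ * c₁)
          + m * (a₀ * b₁ * c₀ * d₁ + m * (b₀ * a₁ * d₀ * c₁)))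
      ≈ (a₀ * b₁ + m * (b₀ * a₁)) * (c₀ * d₁ + m * (d₀ * c₁))
        + (a₀ * d₁ + m * (d₀ * a₁)) * (b₀ * c₁ + m * (c₀ * b₁))
    identity = solve 9 (λ m a₀ a₁ b₀ b₁ c₀ c₁ d₀ d₁ →
      (a₀ :* c₁ :+ m :* (c₀ :* a₁)) :* (b₀ :* d₁ :+ m :* (d₀ :* b₁))
        :+ (a₀ :* b₁ :* c₀ :* d₁ :+ m :* (b₀ :* a₁ :* d₀ :* c₁)
          :+ m :* (a₀ :* b₁ :* c₀ :* d₁ :+ m :* (b₀ :* a₁ :* d₀ :* c₁)))
      := (a₀ :* b₁ :+ m :* (b₀ :* a₁)) :* (c₀ :* d₁ :+ m :* (d₀ :* c₁))
        :+ (a₀ :* d₁ :+ m :* (d₀ :* a₁)) :* (b₀ :* c₁ :+ m :* (c₀ :* b₁))) refl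
      where open Solver

-- Products of minors of the generic matrix.

module Minors {c ℓ : Level} (R : CommutativeRing c ℓ) (n : ℕ) where
  open CommutativeRing R hiding (zero)
  open PlückerIdeal R n using (module R[P]; module R[X]; minor)
  open Substitution R (_≟ᴵ_ {n}) (_≟ᴱ_ {n})
  open R[X] using (constant; ∏; _*ₚ_; _+ₚ_; _≈ₚ_)
  open NonCrossingMonomials {n}
  module P = PolynomialRing R (_≟ᴵ_ {n})
  module X = PolynomialRing R (_≟ᴱ_ {n})
  private module Xᴿ = CommutativeRing X.polynomialRing

  minors : R[P].Monomial → R[X].Polynomial
  minors M = ∏ (map minor M)

  -- For fixed `x` a functional on monomials in the Plücker variables; a polynomial is a relation
  -- among the minors exactly when its linear extension vanishes there for every `x`.
  minorsCoeff : R[X].Monomial → R[P].Monomial → Carrier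
  minorsCoeff x M = R[X].coeff (minors M) x

  substitute-coeff : ∀ f x → R[X].coeff (substitute minor f) x ≈ P.lin (minorsCoeff x) f
  substitute-coeff []            x = refl
  substitute-coeff ((k , M) ∷ f) x =
    trans (X.coeff-++ (constant k *ₚ minors M) (substitute minor f) x)
      (+-cong (X.coeff-constant k (minors M) x) (substitute-coeff f x))

  minors-↭ : ∀ {M N} → M ↭ N → minors M ≈ₚ minors N
  minors-↭ Perm.refl                          = λ _ → refl
  minors-↭ {J ∷ M} {_ ∷ N} (Perm.prep _ p)    =
    X.*ₚ-cong {minor J} {minor J} {minors M} {minors N} (λ _ → refl) (minors-↭ p)
  minors-↭ {J ∷ K ∷ M} {_ ∷ _ ∷ N} (Perm.swap _ _ p) =
    Xᴿ.trans {minor J *ₚ (minor K *ₚ minors M)} {minor K *ₚ (minor J *ₚ minors M)}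
             {minor K *ₚ (minor J *ₚ minors N)}
      (x∙yz≈y∙xz (minor J) (minor K) (minors M))
      (X.*ₚ-cong {minor K} {minor K} {minor J *ₚ minors M} {minor J *ₚ minors N} (λ _ → refl)
        (X.*ₚ-cong {minor J} {minor J} {minors M} {minors N} (λ _ → refl) (minors-↭ p)))
    where open import Algebra.Properties.CommutativeSemigroup Xᴿ.*-commutativeSemigroup
            using (x∙yz≈y∙xz)
  minors-↭ {M} {N} (Perm.trans {ys = L} p q)  =
    Xᴿ.trans {minors M} {minors L} {minors N} (minors-↭ p) (minors-↭ q)

  minorsCoeff-invariant : ∀ x → P.Invariant (minorsCoeff x)
  minorsCoeff-invariant x p = minors-↭ p x

  module Uncross {J K : Index n} (crosses : Crosses J K) where
    private
      a<b = proj₁ crosses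
      b<c = proj₁ (proj₂ crosses)
      c<d = proj₂ (proj₂ crosses)

    -- Named after the columns a < b < c < d, where `J` is (a, c) and `K` is (b, d).
    ab cd ad bc : Index n
    ab = index (j₁ J) (j₁ K) a<b
    cd = index (j₂ J) (j₂ K) c<d
    ad = index (j₁ J) (j₂ K) (ℕ.<-trans a<b (j₁<j₂ K))
    bc = index (j₁ K) (j₂ J) b<c

    ab-cd-< : ∀ N → weight (ab ∷ cd ∷ N) ℕ.< weight (J ∷ K ∷ N)
    ab-cd-< N = weight-pair-< {J} {K} {ab} {cd} N (proj₁ (∸-uncross a<b b<c c<d))

    ad-bc-< : ∀ N → weight (ad ∷ bc ∷ N) ℕ.< weight (J ∷ K ∷ N)
    ad-bc-< N = weight-pair-< {J} {K} {ad} {bc} N (proj₂ (∸-uncross a<b b<c c<d))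

    minors-uncross : ∀ N → minors (J ∷ K ∷ N) ≈ₚ minors (ab ∷ cd ∷ N) +ₚ minors (ad ∷ bc ∷ N)
    minors-uncross N = begin
      minor J *ₚ (minor K *ₚ p)
        ≈⟨ Xᴿ.*-assoc (minor J) (minor K) p ⟨
      (minor J *ₚ minor K) *ₚ p
        ≈⟨ Xᴿ.*-congʳ {p} {minor J *ₚ minor K} {minor ab *ₚ minor cd +ₚ minor ad *ₚ minor bc}
             uncross ⟩
      (minor ab *ₚ minor cd +ₚ minor ad *ₚ minor bc) *ₚ p
        ≈⟨ Xᴿ.distribʳ p (minor ab *ₚ minor cd) (minor ad *ₚ minor bc) ⟩
      (minor ab *ₚ minor cd) *ₚ p +ₚ (minor ad *ₚ minor bc) *ₚ p
        ≈⟨ Xᴿ.+-cong {(minor ab *ₚ minor cd) *ₚ p} {minor ab *ₚ (minor cd *ₚ p)}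
                     {(minor ad *ₚ minor bc) *ₚ p} {minor ad *ₚ (minor bc *ₚ p)}
             (Xᴿ.*-assoc (minor ab) (minor cd) p) (Xᴿ.*-assoc (minor ad) (minor bc) p) ⟩
      minor ab *ₚ (minor cd *ₚ p) +ₚ minor ad *ₚ (minor bc *ₚ p) ∎
      where
      open Relation.Binary.Reasoning.Setoid Xᴿ.setoid
      p = minors N
      x₀ x₁ : Fin (n ℕ.+ 2) → R[X].Polynomial
      x₀ j = R[X].var (Fin.zero , j)
      x₁ j = R[X].var (Fin.suc Fin.zero , j)
      uncross : minor J *ₚ minor K ≈ₚ minor ab *ₚ minor cd +ₚ minor ad *ₚ minor bc
      uncross = plücker X.polynomialRing (x₀ (j₁ J)) (x₁ (j₁ J)) (x₀ (j₁ K)) (x₁ (j₁ K))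
        (x₀ (j₂ J)) (x₁ (j₂ J)) (x₀ (j₂ K)) (x₁ (j₂ K))

  -- Leading terms of products of minors.

  open Relation.Binary.Reasoning.Setoid setoid

  -- Compares monomials in the matrix entries; under it the diagonal term of
  -- every minor beats the antidiagonal one.
  height : R[X].Monomial → ℕ
  height x = ℕ.sum (map (λ (r , j) → toℕ r ℕ.* toℕ j) x)

  height-++ : ∀ x y → height (x ++ y) ≡ height x ℕ.+ height y
  height-++ x y = ≡.trans (≡.cong ℕ.sum (map-++ _ x y)) (ℕ.sum-++ (map _ x) _)

  height-↭ : ∀ {x y} → x ↭ y → height x ≡ height y
  height-↭ p = ℕ.sum-↭ (Perm.map⁺ _ p)

  Below : R[X].Monomial → R[X].Polynomial → Set _
  Below d = All (λ (_ , x) → height x ℕ.< height d)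

  -- The leading term must be the head of the list: a product list starts with the product of the
  -- heads, so this form survives multiplication. The coefficient is 1 only up to `≈`, because it
  -- arises as a product of such coefficients.
  data Leading (d : R[X].Monomial) : R[X].Polynomial → Set (c Level.⊔ ℓ) where
    leading : ∀ {k f} → k ≈ 1# → Below d f → Leading d ((k , d) ∷ f)

  leading-one : Leading [] (constant 1#)
  leading-one = leading refl []

  leading-minor : ∀ J → Leading (entries J) (minor J)
  leading-minor J = leading (*-identityˡ 1#) (antidiagonal<diagonal ∷ [])
    where
    antidiagonal<diagonal : toℕ (j₁ J) ℕ.+ 0 ℕ.+ 0 ℕ.< toℕ (j₂ J) ℕ.+ 0 ℕ.+ 0
    antidiagonal<diagonal = ℕ.+-monoˡ-< 0 (ℕ.+-monoˡ-< 0 (j₁<j₂ J))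

  leading-* : ∀ {d e f g} → Leading d f → Leading e g → Leading (d ++ e) (f *ₚ g)
  leading-* {d} {e} (leading {f = f} k≈1 f<) (leading {k = k′} {g} k′≈1 g<) =
    leading (trans (*-cong k≈1 k′≈1) (*-identityˡ 1#)) (All.++⁺
      -- First the leading term of the first factor times the lower terms of the second, then the
      -- lower terms of the first times every term of the second; heights add, and one of them is
      -- strictly lower each time.
      (All.map⁺ (All.map (λ {t} y<e → below (d , proj₂ t) (ℕ.+-monoʳ-< (height d) y<e)) g<))
      (All.cartesianProductWith⁺ (≡.setoid _) (≡.setoid _) _ f ((k′ , e) ∷ g)
        λ {(_ , x)} {(_ , y)} x∈ y∈ → below (x , y)
          (ℕ.+-mono-<-≤ (All.lookup f< x∈) (All.lookup (ℕ.≤-refl ∷ All.map ℕ.<⇒≤ g<) y∈))))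
    where
    below : ∀ ((x , y) : R[X].Monomial × R[X].Monomial) →
      height x ℕ.+ height y ℕ.< height d ℕ.+ height e → height (x ++ y) ℕ.< height (d ++ e)
    below (x , y) = ≡.subst₂ ℕ._<_ (≡.sym (height-++ x y)) (≡.sym (height-++ d e))

  leading-minors : ∀ M → Leading (diagonal M) (minors M)
  leading-minors []      = leading-one
  leading-minors (J ∷ M) = leading-* (leading-minor J) (leading-minors M)

  leading-coeff : ∀ {d f} → Leading d f → R[X].coeff f d ≈ 1#
  leading-coeff {d} (leading {k} {f} k≈1 f<) = trans (X.coeff-hit k f ↭-refl)
    (trans (+-cong k≈1 (X.coeff-absent f (All.map (λ lt p → ℕ.<⇒≢ lt (height-↭ p)) f<)))
      (+-identityʳ 1#))

  above-leading-coeff : ∀ {d f x} → Leading d f → height d ℕ.≤ height x → d ≁ x →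
    R[X].coeff f x ≈ 0#
  above-leading-coeff (leading {k} {f} _ f<) d≤x d≁x = trans (X.coeff-miss k f d≁x)
    (X.coeff-absent f (All.map (λ lt p → ℕ.<⇒≢ (ℕ.<-≤-trans lt d≤x) (height-↭ p)) f<))

  -- Linear independence of the non-crossing monomials modulo the relations.

  NonCrossings : R[P].Polynomial → Set c
  NonCrossings = All (λ (_ , M) → NonCrossing M)

  diagonalHeight : R[P].Monomial → ℕ
  diagonalHeight M = height (diagonal M)

  height-bound : ∀ (f : R[P].Polynomial) →
    ∃ λ B → All (λ (_ , M) → diagonalHeight M ℕ.≤ B) f
  height-bound []            = 0 , []
  height-bound ((_ , M) ∷ f) with B , ≤B ← height-bound f =
    diagonalHeight M ℕ.⊔ B ,
      ℕ.m≤m⊔n _ B ∷ All.map (λ M≤B → ℕ.≤-trans M≤B (ℕ.m≤n⊔m (diagonalHeight M) B)) ≤B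

  -- Comparing coefficients at the diagonal terms, the highest first.
  independent : ∀ f → NonCrossings f → (∀ x → P.lin (minorsCoeff x) f ≈ 0#) →
    ∀ M → NonCrossing M → R[P].coeff f M ≈ 0#
  independent f ncs relation M nc with B , ≤B ← height-bound f =
    -- The first argument is fuel, and height plus fuel always exceeds `B`; the amount `suc B` is
    -- enough for every `M`.
    descend (suc B) M nc (ℕ.m≤n+m (suc B) (diagonalHeight M))
    where
    descend : ∀ k M → NonCrossing M → B ℕ.< diagonalHeight M ℕ.+ k → R[P].coeff f M ≈ 0#
    -- Without fuel the diagonal of `M` is higher than that of every monomial listed in `f`, so `M`
    -- is not listed.
    descend zero M nc B< = P.coeff-absent f (All.map
      (λ ≤B p → ℕ.<⇒≱ B< (ℕ.≤-trans (ℕ.≤-reflexive (≡.trans (ℕ.+-identityʳ _)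
        (≡.sym (height-↭ (diagonal-↭ p))))) ≤B)) ≤B)
    descend (suc k) M nc B< = begin
      R[P].coeff f M
        ≈⟨ *-identityʳ _ ⟨
      R[P].coeff f M * 1#
        ≈⟨ *-congˡ (leading-coeff (leading-minors M)) ⟨
      R[P].coeff f M * minorsCoeff (diagonal M) M
        ≈⟨ P.lin-single (minorsCoeff-invariant (diagonal M)) M f (All.map (λ {t} → other {t}) ncs) ⟨
      P.lin (minorsCoeff (diagonal M)) f
        ≈⟨ relation (diagonal M) ⟩
      0# ∎
      where
      other : ∀ {t : Carrier × R[P].Monomial} → let (_ , M′) = t in NonCrossing M′ → M′ ≁ M →
        R[P].coeff f M′ ≈ 0# ⊎ minorsCoeff (diagonal M) M′ ≈ 0#
      -- A higher diagonal means coefficient zero by induction. Otherwise the leading term of the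
      -- minors of `M′` is no higher than the diagonal of `M` and, by `diagonal-injective`,
      -- different from it.
      other {_ , M′} nc′ M′≁M with diagonalHeight M ℕ.<? diagonalHeight M′
      ... | yes M<M′ = inj₁ (descend k M′ nc′ (ℕ.<-≤-trans B< (ℕ.≤-trans
                         (ℕ.≤-reflexive (ℕ.+-suc _ k)) (ℕ.+-monoˡ-≤ k M<M′))))
      ... | no M≮M′  = inj₂ (above-leading-coeff (leading-minors M′) (ℕ.≮⇒≥ M≮M′)
                         (M′≁M ∘ diagonal-injective M′ M nc′ nc))

  -- Straightening into non-crossing monomials.

  -- `congruent` is congruence modulo the relations among the minors, tested on each coefficient of
  -- the images. In `top`, `w` is meant as a bound for the weights in `f`, so that the non-crossing
  -- monomials of top weight are undisturbed.
  record Straightening (f : R[P].Polynomial) (w : ℕ) : Set (c Level.⊔ ℓ) where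
    field
      normal      : R[P].Polynomial
      nonCrossing : NonCrossings normal
      congruent   : ∀ x → P.lin (minorsCoeff x) normal ≈ P.lin (minorsCoeff x) f
      top         : ∀ M → NonCrossing M → w ℕ.≤ weight M → R[P].coeff normal M ≈ R[P].coeff f M
  open Straightening

  straighten-++ : ∀ {f g w} → Straightening f w → Straightening g w → Straightening (f ++ g) w
  straighten-++ {f} {g} s t = record
    { normal      = normal s ++ normal t
    ; nonCrossing = All.++⁺ (nonCrossing s) (nonCrossing t)
    ; congruent   = λ x → trans (P.lin-++ _ (normal s) (normal t))
        (trans (+-cong (congruent s x) (congruent t x)) (sym (P.lin-++ _ f g)))
    ; top         = λ M nc w≤ → trans (P.coeff-++ (normal s) (normal t) M)
        (trans (+-cong (top s M nc w≤) (top t M nc w≤)) (sym (P.coeff-++ f g M))) }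

  -- Induction on the weight: a crossing pair is replaced by its two uncrossings, both lighter, so
  -- no non-crossing monomial as heavy as `M` gains a nonzero coefficient.
  straighten-term : ∀ k M → Straightening ((k , M) ∷ []) (weight M)
  straighten-term k M = <-rec (λ w → ∀ M → weight M ≡ w → Straightening ((k , M) ∷ []) w)
    step (weight M) M ≡.refl
    where
    step : ∀ w → (∀ {v} → v ℕ.< w → ∀ M → weight M ≡ v → Straightening ((k , M) ∷ []) v) →
      ∀ M → weight M ≡ w → Straightening ((k , M) ∷ []) w
    step w rec M ≡.refl with crossing-pair M
    ... | inj₁ nc = record
      { normal = (k , M) ∷ [] ; nonCrossing = nc ∷ []
      ; congruent = λ _ → refl ; top = λ _ _ _ → refl }
    ... | inj₂ (J , K , J∈ , K∈ , crosses) with N , p ← crosses-↭ J∈ K∈ crosses = record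
      { normal      = normal s ++ normal t
      ; nonCrossing = All.++⁺ (nonCrossing s) (nonCrossing t)
      ; congruent   = congruence
      ; top         = λ L ncL w≤ → begin
          R[P].coeff (normal s ++ normal t) L
            ≈⟨ P.coeff-++ (normal s) (normal t) L ⟩
          R[P].coeff (normal s) L + R[P].coeff (normal t) L
            ≈⟨ +-cong (vanish s M₁<M L ncL w≤) (vanish t M₂<M L ncL w≤) ⟩
          0# + 0#
            ≈⟨ +-identityˡ 0# ⟩
          0#
            ≈⟨ P.coeff-miss k [] (λ (M↭L : M ↭ L) → nonCrossing-↭ (↭-sym M↭L) ncL J∈ K∈ crosses) ⟨
          R[P].coeff ((k , M) ∷ []) L ∎ }
      where
      open Uncross {J} {K} crosses
      M₁ = ab ∷ cd ∷ N
      M₂ = ad ∷ bc ∷ N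
      M₁<M : weight M₁ ℕ.< weight M
      M₁<M = ≡.subst (weight M₁ ℕ.<_) (≡.sym (weight-↭ p)) (ab-cd-< N)
      M₂<M : weight M₂ ℕ.< weight M
      M₂<M = ≡.subst (weight M₂ ℕ.<_) (≡.sym (weight-↭ p)) (ad-bc-< N)
      s = rec M₁<M M₁ ≡.refl
      t = rec M₂<M M₂ ≡.refl
      vanish : ∀ {M′} (s : Straightening ((k , M′) ∷ []) (weight M′)) → weight M′ ℕ.< weight M →
        ∀ L → NonCrossing L → weight M ℕ.≤ weight L → R[P].coeff (normal s) L ≈ 0#
      vanish {M′} s M′<M L ncL M≤L = trans (top s L ncL (ℕ.<⇒≤ (ℕ.<-≤-trans M′<M M≤L)))
        (P.coeff-miss k [] λ (M′↭L : M′ ↭ L) → ℕ.<⇒≢ (ℕ.<-≤-trans M′<M M≤L) (weight-↭ M′↭L))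
      congruence : ∀ x → P.lin (minorsCoeff x) (normal s ++ normal t) ≈ k * minorsCoeff x M + 0#
      congruence x = begin
        P.lin (minorsCoeff x) (normal s ++ normal t)
          ≈⟨ P.lin-++ _ (normal s) (normal t) ⟩
        P.lin (minorsCoeff x) (normal s) + P.lin (minorsCoeff x) (normal t)
          ≈⟨ +-cong (trans (congruent s x) (+-identityʳ _)) (trans (congruent t x) (+-identityʳ _)) ⟩
        k * minorsCoeff x M₁ + k * minorsCoeff x M₂
          ≈⟨ distribˡ k _ _ ⟨
        k * (minorsCoeff x M₁ + minorsCoeff x M₂)
          ≈⟨ *-congˡ (X.coeff-++ (minors M₁) (minors M₂) x) ⟨
        k * R[X].coeff (minors M₁ +ₚ minors M₂) x
          ≈⟨ *-congˡ (minors-uncross N x) ⟨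
        k * minorsCoeff x (J ∷ K ∷ N)
          ≈⟨ *-congˡ (minorsCoeff-invariant x p) ⟨
        k * minorsCoeff x M
          ≈⟨ +-identityʳ _ ⟨
        k * minorsCoeff x M + 0# ∎

  weaken : ∀ {f v w} → v ℕ.≤ w → Straightening f v → Straightening f w
  weaken v≤w s = record
    { normal = normal s ; nonCrossing = nonCrossing s ; congruent = congruent s
    ; top = λ M nc w≤M → top s M nc (ℕ.≤-trans v≤w w≤M) }

  straighten : ∀ {w} f → All (λ (_ , M) → weight M ℕ.≤ w) f → Straightening f w
  straighten []            []         = record
    { normal = [] ; nonCrossing = [] ; congruent = λ _ → refl ; top = λ _ _ _ → refl }
  straighten ((k , M) ∷ f) (M≤w ∷ ≤w) =
    straighten-++ (weaken M≤w (straighten-term k M)) (straighten f ≤w)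

  -- Terms heavier than `M` cancel and may be dropped; straightening the rest at `weight M` keeps
  -- the coefficient of `M`, and independence forces it to vanish.
  nonCrossing-not-heaviest : ∀ f → (∀ x → P.lin (minorsCoeff x) f ≈ 0#) →
    ∀ M → NonCrossing M → (∀ M′ → weight M ℕ.< weight M′ → R[P].coeff f M′ ≈ 0#) →
    R[P].coeff f M ≈ 0#
  nonCrossing-not-heaviest f relation M nc heavier = begin
    R[P].coeff f M           ≈⟨ P.coeff-restrict light? light-resp f ℕ.≤-refl ⟨
    R[P].coeff f′ M          ≈⟨ top s M nc ℕ.≤-refl ⟨
    R[P].coeff (normal s) M  ≈⟨ independent (normal s) (nonCrossing s) relation′ M nc ⟩
    0# ∎
    where
    light? = λ M′ → weight M′ ℕ.≤? weight M
    light-resp : ∀ {N N′} → N ↭ N′ → weight N ℕ.≤ weight M → weight N′ ℕ.≤ weight M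
    light-resp p = ≡.subst (ℕ._≤ weight M) (weight-↭ p)
    -- Heavier monomials may still be listed in `f` with cancelling terms, so they are filtered out
    -- before straightening.
    f′ = P.restrict light? f
    s : Straightening f′ (weight M)
    s = straighten f′ (All.all-filter (light? ∘ proj₂) f)
    f′≈f : ∀ N → R[P].coeff f′ N ≈ R[P].coeff f N
    f′≈f N with light? N
    ... | yes N≤M = P.coeff-restrict light? light-resp f N≤M
    ... | no N≰M  = trans (P.coeff-restrict-reject light? light-resp f N≰M)
                      (sym (heavier N (ℕ.≰⇒> N≰M)))
    relation′ : ∀ x → P.lin (minorsCoeff x) (normal s) ≈ 0#
    relation′ x = trans (congruent s x)
      (trans (P.lin-congₚ {f = f′} {f} (minorsCoeff-invariant x) f′≈f) (relation x))

-- Stability of equality of real and complex numbers.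

-- A Cauchy sequence is within ε of its limit from an index computed without
-- knowing the limit, and comparison of rationals is decidable.
≈ᴿ-stable : Stable _≈ᴿ_
≈ᴿ-stable x y ¬¬x≈y = null λ ε 0<ε →
  let open ℝ-Lemmas
      d = λ n → seq x n ℚ.- seq y n
      N , close = +-cauchy {seq x} {λ n → ℚ.- seq y n} (cauchy x) (neg-cauchy {seq y} (cauchy y))
                    _ (half>0 0<ε)
  in N , λ n N≤n → decidable-stable (ℚ.∣ d n ∣ ℚ.<? ε) λ ¬small → ¬¬x≈y λ (null x≈y) →
    let M , small = x≈y _ (half>0 0<ε)
        k = M ℕ.⊔ N
    in ¬small (≡.subst (λ q → ℚ.∣ q ∣ ℚ.< ε) (cancel (d n) (d k))
         (+-small (d n ℚ.- d k) (d k) (close n k N≤n (ℕ.m≤n⊔m M N)) (small k (ℕ.m≤m⊔n M N))))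

1ᴿ≉0ᴿ : ¬ 1ᴿ ≈ᴿ 0ᴿ
1ᴿ≉0ᴿ (null 1≈0) with N , small ← 1≈0 1ℚ (ℚ.positive⁻¹ 1ℚ) = ℚ.<-irrefl ≡.refl (small N ℕ.≤-refl)

open Complexification ℝ-commutativeRing using (re-≈; im-≈)

module ℂ = CommutativeRing ℂ-commutativeRing

-- Occurrence in a polynomial is a negated equation, so stability is what turns failure to occur
-- into a zero coefficient.
≈ᶜ-stable : Stable ℂ._≈_
≈ᶜ-stable z w ¬¬z≈w = record
  { re-≈ = ≈ᴿ-stable _ _ λ re≉ → ¬¬z≈w (re≉ ∘ re-≈)
  ; im-≈ = ≈ᴿ-stable _ _ λ im≉ → ¬¬z≈w (im≉ ∘ im-≈) }

1ᶜ≉0ᶜ : ¬ ℂ.1# ℂ.≈ ℂ.0#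
1ᶜ≉0ᶜ = 1ᴿ≉0ᴿ ∘ re-≈

-- The initial ideal and its non-crossing complement.

module InitialIdeal
  {c ℓ s : Level} (R : CommutativeRing c ℓ)
  (stable : Stable (CommutativeRing._≈_ R))
  (1≉0 : ¬ CommutativeRing._≈_ R (CommutativeRing.1# R) (CommutativeRing.0# R))
  {n : ℕ} (_≺_ : Rel (List (Index n)) s) (order : IsReverseWeightOrder _≺_)
  where
  private module R = CommutativeRing R
  open PlückerIdeal R n using (I₂; minor; module R[X]; module R[P])
  open Substitution R (_≟ᴵ_ {n}) (_≟ᴱ_ {n})
  open R[P]
  open NonCrossingMonomials {n}
  open Minors R n
  open IsReverseWeightOrder order
  open IsStrictTotalOrder isStrictTotalOrder using (asym)

  -- A heavier monomial would precede `m`, against minimality. This refutes only its occurrence;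
  -- `stable` then makes its coefficient zero.
  initial-heaviest : ∀ {f m} → IsInitial _≺_ f m →
    ∀ m′ → weight m ℕ.< weight m′ → coeff f m′ R.≈ R.0#
  initial-heaviest {f} {m} (_ , least) m′ m<m′ = stable _ _ λ occurs → absurd (least m′ occurs)
    where
    absurd : ¬ (m ≺ m′ ⊎ m ↭ m′)
    absurd (inj₁ m≺m′) = asym m≺m′ (reverse-weight m<m′)
    absurd (inj₂ m↭m′) = ℕ.<⇒≢ m<m′ (weight-↭ m↭m′)

  initial-crosses : ∀ {f m} → I₂ f → IsInitial _≺_ f m → ¬ NonCrossing m
  initial-crosses {f} {m} f∈I init nc = proj₁ init
    (nonCrossing-not-heaviest f (λ x → R.trans (R.sym (substitute-coeff f x)) (f∈I x)) m nc
      (initial-heaviest {f} init))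

  -- A claim about all coefficients of an arbitrary element passes through every way of generating
  -- the ideal: initial monomials cross, and so do multiples of crossing monomials.
  nonCrossing-absent : ∀ {f} → in-ideal _≺_ I₂ f → ∀ m → NonCrossing m → coeff f m R.≈ R.0#
  nonCrossing-absent (generator (f , m₀ , f∈I , init , g≈)) m nc =
    R.trans (g≈ m) (P.δ-miss λ p → initial-crosses {f} f∈I init (nonCrossing-↭ (↭-sym p) nc))
  nonCrossing-absent zero m nc = R.refl
  nonCrossing-absent (add {f} {g} f∈ g∈) m nc = R.trans (P.coeff-++ f g m)
    (R.trans (R.+-cong (nonCrossing-absent f∈ m nc) (nonCrossing-absent g∈ m nc))
      (R.+-identityˡ R.0#))
  nonCrossing-absent (respects f≈g f∈) m nc = R.trans (R.sym (f≈g m)) (nonCrossing-absent f∈ m nc)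
  nonCrossing-absent (absorb g {f} f∈) m nc = R.trans (P.coeff≈lin (g *ₚ f) m)
    (R.trans (P.lin-*ₚ (P.δ m) g f) (R.trans (P.lin-cong multiples g) (P.lin-zero g)))
    where
    multiples : ∀ m′ → P.lin (λ m″ → P.δ m (m′ ++ m″)) f R.≈ R.0#
    multiples m′ = P.lin-vanish (P.++-invariantˡ {P.δ m} (P.δ-invariant m) m′) f
      (All.tabulate λ {(_ , m″)} _ → vanish m″)
      where
      vanish : ∀ m″ → coeff f m″ R.≈ R.0# ⊎ P.δ m (m′ ++ m″) R.≈ R.0#
      vanish m″ with permutation? _≟ᴵ_ (m′ ++ m″) m
      ... | no _  = inj₂ (R.+-identityˡ R.0#)
      -- `m″` divides `m`, so it inherits non-crossing and the induction hypothesis applies.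
      ... | yes p = inj₁ (nonCrossing-absent f∈ m″ λ J∈ K∈ →
              nonCrossing-↭ (↭-sym p) nc (∈-++⁺ʳ m′ J∈) (∈-++⁺ʳ m′ K∈))

  -- The witness is a Plücker relation times the remaining factors: `M` minus its two uncrossings,
  -- with `M` as heaviest and hence initial monomial.
  crossing-initial : ∀ {M} {J K : Index n} → J ∈ M → K ∈ M → Crosses J K →
    in-ideal _≺_ I₂ (monomial M)
  crossing-initial {M} {J} {K} J∈ K∈ crosses with N , p ← crosses-↭ J∈ K∈ crosses =
    generator (f , M , f∈I , (occurs , least) , λ _ → R.refl)
    where
    open Uncross {J} {K} crosses
    M₁ = ab ∷ cd ∷ N
    M₂ = ad ∷ bc ∷ N
    M₁<M : weight M₁ ℕ.< weight M
    M₁<M = ≡.subst (weight M₁ ℕ.<_) (≡.sym (weight-↭ p)) (ab-cd-< N)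
    M₂<M : weight M₂ ℕ.< weight M
    M₂<M = ≡.subst (weight M₂ ℕ.<_) (≡.sym (weight-↭ p)) (ad-bc-< N)
    f₀ f : Polynomial
    f₀ = (R.1# , M₁) ∷ (R.1# , M₂) ∷ []
    f = monomial M -ₚ f₀
    f∈I : I₂ f
    f∈I x = begin
      R[X].coeff (substitute minor f) x    ≈⟨ substitute-coeff f x ⟩
      P.lin (minorsCoeff x) f              ≈⟨ P.lin-++ (minorsCoeff x) (monomial M) (-ₚ f₀) ⟩
      P.lin (minorsCoeff x) (monomial M) R.+ P.lin (minorsCoeff x) (-ₚ f₀)
        ≈⟨ R.+-congˡ (P.lin-neg (minorsCoeff x) f₀) ⟩
      P.lin (minorsCoeff x) (monomial M) R.- P.lin (minorsCoeff x) f₀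
        ≈⟨ R.+-congʳ relation ⟩
      P.lin (minorsCoeff x) f₀ R.- P.lin (minorsCoeff x) f₀
        ≈⟨ R.-‿inverseʳ _ ⟩
      R.0# ∎
      where
      open import Relation.Binary.Reasoning.Setoid R.setoid
      relation : P.lin (minorsCoeff x) (monomial M) R.≈ P.lin (minorsCoeff x) f₀
      relation = begin
        R.1# R.* minorsCoeff x M R.+ R.0#
          ≈⟨ R.trans (R.+-identityʳ _) (R.*-identityˡ _) ⟩
        minorsCoeff x M
          ≈⟨ minorsCoeff-invariant x p ⟩
        minorsCoeff x (J ∷ K ∷ N)
          ≈⟨ minors-uncross N x ⟩
        R[X].coeff (minors M₁ R[X].+ₚ minors M₂) x
          ≈⟨ X.coeff-++ (minors M₁) (minors M₂) x ⟩
        minorsCoeff x M₁ R.+ minorsCoeff x M₂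
          ≈⟨ R.+-cong (R.*-identityˡ _) (R.trans (R.+-identityʳ _) (R.*-identityˡ _)) ⟨
        P.lin (minorsCoeff x) f₀ ∎
    lighter : ∀ {M′} → weight M′ ℕ.< weight M → M′ ≁ M
    lighter M′<M p = ℕ.<⇒≢ M′<M (weight-↭ p)
    occurs : Occurs M f
    -- The uncrossings are lighter than `M`, hence different monomials, so nothing cancels its
    -- coefficient 1.
    occurs = 1≉0 ∘ R.trans (R.sym (R.trans (P.coeff-hit R.1# {M} (-ₚ f₀) {M} ↭-refl)
      (R.trans (R.+-congˡ (P.coeff-absent {M} (-ₚ f₀) (lighter M₁<M ∷ lighter M₂<M ∷ [])))
        (R.+-identityʳ R.1#))))
    least : ∀ m → Occurs m f → M ≺ m ⊎ M ↭ m
    least m m∈f = locate (permutation? _≟ᴵ_ M m) (permutation? _≟ᴵ_ M₁ m) (permutation? _≟ᴵ_ M₂ m)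
      where
      locate : Dec (M ↭ m) → Dec (M₁ ↭ m) → Dec (M₂ ↭ m) → M ≺ m ⊎ M ↭ m
      locate (yes M↭m) _ _ = inj₂ M↭m
      locate _ (yes M₁↭m) _ = inj₁ (reverse-weight (≡.subst (ℕ._< weight M) (weight-↭ M₁↭m) M₁<M))
      locate _ _ (yes M₂↭m) = inj₁ (reverse-weight (≡.subst (ℕ._< weight M) (weight-↭ M₂↭m) M₂<M))
      locate (no M≁m) (no M₁≁m) (no M₂≁m) =
        contradiction (P.coeff-absent f (M≁m ∷ M₁≁m ∷ M₂≁m ∷ [])) m∈f

  nonCrossing⇔nonInitial : ∀ M → NonCrossing M ⇔ (¬ in-ideal _≺_ I₂ (monomial M))
  nonCrossing⇔nonInitial M = mk⇔ {A = NonCrossing M}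
    -- Membership in the initial ideal would make the coefficient of `M` in its own monomial zero,
    -- but it is 1.
    (λ nc M∈ → 1≉0 (R.trans (R.sym (P.δ-hit {M} {M} ↭-refl))
      (nonCrossing-absent M∈ M λ {J} {K} → nc {J} {K})))
    (λ M∉ J∈ K∈ crosses → M∉ (crossing-initial J∈ K∈ crosses))

theorem30 : ∀ {s : Level} (n : ℕ) → 1 ≤ n →
    (_≺_ : Rel (ℂ[P].Monomial n) s) → IsReverseWeightOrder _≺_ →
    ∀ M → NonCrossing M ⇔ NonInitial _≺_ M
theorem30 n _ _≺_ order =
  InitialIdeal.nonCrossing⇔nonInitial ℂ-commutativeRing ≈ᶜ-stable 1ᶜ≉0ᶜ _≺_ order
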